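{- Let $\mathbb K$ be a commutative ring and $V$ a $\mathbb K$-module. The unit, the counit, the external product $*$ and the coproduct $\Delta$ defined below endow $\mathscr F(V)=\bigoplus_{n\geq0}\mathscr F_n(V)$ with the structure of a graded bialgebra over $\mathbb K$.
   Context: For $n\geq0$, $\mathfrak S_n$ is the symmetric group on $\{1,\dots,n\}$ ($\mathfrak S_0$ trivial), with unit $e_n$; permutations are written as words $\sigma(1)\sigma(2)\cdots\sigma(n)$. For a composition $\mathbf c=(c_1,\dots,c_k)$ of $n$ with $t_i=c_1+\dots+c_i$, let $X_{\mathbf c}$ be the set of $\sigma\in\mathfrak S_n$ increasing on each interval $[t_{i-1}+1,t_i]$ and $x_{\mathbf c}=\sum_{\sigma\in X_{\mathbf c}}\sigma\in\mathbb K\mathfrak S_n$. For $\sigma\in\mathfrak S_n,\sigma'\in\mathfrak S_{n'}$, $\sigma\times\sigma'\in\mathfrak S_{n+n'}$ equals $\sigma$ on $[1,n]$ and sends $a\in[n+1,n+n']$ to $n+\sigma'(a-n)$. The standardization of a word $a_1\cdots a_m$ over a totally ordered alphabet is the permutation obtained by replacing its letters by $1,\dots,m$, the smallest letters first and equal letters from left to right. $\mathscr F_n(V)=V^{\otimes n}\otimes\mathbb K\mathfrak S_n$, whose elements $(v_1\otimes\cdots\otimes v_n)\otimes\sigma$ are written $(v_1\otimes\cdots\otimes v_n)\#\sigma$; $\mathbb K\mathfrak S_n$ acts on the left by $\pi\cdot[(v_1\otimes\cdots\otimes v_n)\#\sigma]=[(v_{\pi^{ -1}(1)}\otimes\cdots\otimes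 v_{\pi^{ -1}(n)})\#(\pi\sigma)]$ (extended linearly). External product: for $\alpha=(v_1\otimes\cdots\otimes v_n)\#\sigma$ and $\alpha'=(v'_1\otimes\cdots\otimes v'_{n'})\#\sigma'$, $\alpha*\alpha'=x_{(n,n')}\cdot[(v_1\otimes\cdots\otimes v_n\otimes v'_1\otimes\cdots\otimes v'_{n'})\#(\sigma\times\sigma')]$, extended bilinearly. Coproduct: $\Delta((v_1\otimes\cdots\otimes v_n)\#\sigma)=\sum_{n'=0}^n[(v_1\otimes\cdots\otimes v_{n'})\#\pi_{n'}]\otimes[(v_{n'+1}\otimes\cdots\otimes v_n)\#\pi'_{n-n'}]$, where $\pi_{n'}\in\mathfrak S_{n'}$ is the inverse of the standardization of the word $\sigma^{ -1}(1)\cdots\sigma^{ -1}(n')$ and $\pi'_{n-n'}\in\mathfrak S_{n-n'}$ is the inverse of the standardization of $\sigma^{ -1}(n'+1)\cdots\sigma^{ -1}(n)$. The unit is the inclusion of $\mathscr F_0(V)=\mathbb K$, the counit the projection onto $\mathscr F_0(V)=\mathbb K$. -}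

module Defs where

open import Level using (Level; _⊔_) renaming (suc to lsuc)
open import Algebra.Bundles using (CommutativeRing)
open import Algebra.Module.Bundles using (Module)
open import Data.Nat as ℕ using (ℕ; zero; suc; _+_; _∸_)
open import Data.Nat.Properties using (m+[n∸m]≡n)
open import Data.Fin as Fin using (Fin; zero; suc; toℕ; fromℕ<; splitAt; punchIn; cast)
open import Data.Fin.Properties using (all?; any?; toℕ≤pred[n]) renaming (_≟_ to _≟ᶠ_; _<?_ to _<?ᶠ_)
open import Data.Vec.Functional using () renaming (_++_ to _++ᵛ_)
open import Data.List as List using (List; []; _∷_; filter; allFin; concatMap; foldr; length)
open import Data.Product using (Σ; Σ-syntax; _×_; _,_; proj₁; proj₂)
open import Data.Sum using ([_,_]′)
open import Relation.Nullary using (Dec; yes; no; ¬_)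
open import Relation.Nullary.Decidable using (_→-dec_)
open import Relation.Binary.PropositionalEquality using (_≡_)

-- Permutations.  An element of 𝔖ₙ is represented canonically by a code
-- (no proof obligations): the code  i ∷ c  of 𝔖_{n+1} denotes the
-- permutation σ with σ(0) = i and σ(j+1) = punchIn i (τ j), where τ is
-- the permutation of 𝔖ₙ denoted by c.  (decode is a bijection from
-- codes onto 𝔖ₙ; permutations act as functions Fin n → Fin n, and
-- words σ(1)⋯σ(n) correspond to σ 0, …, σ (n-1).)

data Perm : ℕ → Set where
  []  : Perm zero
  _∷_ : ∀ {n} → Fin (suc n) → Perm n → Perm (suc n)

decode : ∀ {n} → Perm n → Fin n → Fin n
decode (i ∷ c) zero    = i
decode (i ∷ c) (suc j) = punchIn i (decode c j)

-- total "punch out" (the value in the diagonal case is irrelevant for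
-- bijections)
pout : ∀ {n} → Fin (suc (suc n)) → Fin (suc (suc n)) → Fin (suc n)
pout zero    zero    = zero
pout zero    (suc k) = k
pout {zero}  (suc i) zero    = zero
pout {zero}  (suc i) (suc k) = zero
pout {suc n} (suc i) zero    = zero
pout {suc n} (suc i) (suc k) = suc (pout i k)

-- encode f is the code of f whenever f is a bijection
encode : ∀ {n} → (Fin n → Fin n) → Perm n
encode {zero}        f = []
encode {suc zero}    f = f zero ∷ []
encode {suc (suc n)} f = f zero ∷ encode (λ j → pout (f zero) (f (suc j)))

allPerms : ∀ n → List (Perm n)
allPerms zero    = [] ∷ []
allPerms (suc n) = concatMap (λ i → List.map (i ∷_) (allPerms n)) (allFin (suc n))

inv : ∀ {n} → (Fin n → Fin n) → Fin n → Fin n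
inv f j with any? (λ i → f i ≟ᶠ j)
... | yes (i , _) = i
... | no  _       = j

_∘ₚ_ : ∀ {n} → Perm n → Perm n → Perm n
π ∘ₚ σ = encode (λ i → decode π (decode σ i))

invₚ : ∀ {n} → Perm n → Perm n
invₚ σ = encode (inv (decode σ))

_×ₚ_ : ∀ {n n'} → Perm n → Perm n' → Perm (n + n')
_×ₚ_ {n} {n'} σ σ' =
  encode (λ a → [ (λ i → (decode σ i Fin.↑ˡ n')) , (λ j → (n Fin.↑ʳ decode σ' j)) ]′ (splitAt n a))

IsShuffle : ∀ n n' → Perm (n + n') → Set
IsShuffle n n' π =
  (∀ (i j : Fin n) → i Fin.< j → decode π ((i Fin.↑ˡ n')) Fin.< decode π ((j Fin.↑ˡ n'))) ×
  (∀ (i j : Fin n') → i Fin.< j → decode π ((n Fin.↑ʳ i)) Fin.< decode π ((n Fin.↑ʳ j)))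

isShuffle? : ∀ n n' (π : Perm (n + n')) → Dec (IsShuffle n n' π)
isShuffle? n n' π with
  all? (λ i → all? (λ j → (i <?ᶠ j) →-dec (decode π ((i Fin.↑ˡ n')) <?ᶠ decode π ((j Fin.↑ˡ n')))))
  | all? (λ i → all? (λ j → (i <?ᶠ j) →-dec (decode π ((n Fin.↑ʳ i)) <?ᶠ decode π ((n Fin.↑ʳ j)))))
... | yes p | yes q = yes (p , q)
... | no ¬p | _     = no (λ z → ¬p (proj₁ z))
... | yes _ | no ¬q = no (λ z → ¬q (proj₂ z))

shuffles : ∀ n n' → List (Perm (n + n'))
shuffles n n' = filter (isShuffle? n n') (allPerms (n + n'))

countᵈ : ∀ {k} {P : Fin k → Set} → ((i : Fin k) → Dec (P i)) → ℕ
countᵈ P? = length (filter P? (allFin _))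

clamp : ∀ {k} → ℕ → Fin k → Fin k
clamp {k} r i with r ℕ.<? k
... | yes r<k = fromℕ< r<k
... | no  _   = i

std : ∀ {k N} → (Fin k → Fin N) → Fin k → Fin k
std w i = clamp (countᵈ (λ j → w j <?ᶠ w i)
                 + countᵈ (λ j → (j <?ᶠ i) Relation.Nullary.Decidable.×-dec (w j ≟ᶠ w i))) i

module Construction {c ℓ m ℓm} (K : CommutativeRing c ℓ) (V : Module K m ℓm) where

  open CommutativeRing K using ()
    renaming (Carrier to 𝕂; _≈_ to _≈ₖ_; _+_ to _+ₖ_; _*_ to _*ₖ_; -_ to -ₖ_; 0# to 0ₖ; 1# to 1ₖ)
  open Module V using (Carrierᴹ; _≈ᴹ_; _+ᴹ_; _*ₗ_)

  -- Formal 𝕂-linear combinations over a set of generators G, and the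
  -- 𝕂-module presented by generators G and relations R: the quotient of
  -- the free 𝕂-module on G by the submodule generated by the
  -- differences x - y with R x y.  Quotients are modelled as setoids:
  -- Term G with the congruence Cl R.

  infixl 6 _⊕_
  infixr 7 _⊙_
  infix 4 _≈F_ _≈FF_ _≈FFF_
  infixl 7 _*_ _*₂_
  infixr 8 _⊗ₜ_

  data Term {g} (G : Set g) : Set (c ⊔ g) where
    gen : G → Term G
    𝟘   : Term G
    _⊕_ : Term G → Term G → Term G
    _⊙_ : 𝕂 → Term G → Term G

  data Cl {g r} {G : Set g} (R : Term G → Term G → Set r)
       : Term G → Term G → Set (c ⊔ ℓ ⊔ g ⊔ r) where
    base       : ∀ {x y} → R x y → Cl R x y
    refl       : ∀ {x} → Cl R x x
    sym        : ∀ {x y} → Cl R x y → Cl R y x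
    trans      : ∀ {x y z} → Cl R x y → Cl R y z → Cl R x z
    ⊕-cong     : ∀ {x x' y y'} → Cl R x x' → Cl R y y' → Cl R (x ⊕ y) (x' ⊕ y')
    ⊙-cong     : ∀ {a b x y} → a ≈ₖ b → Cl R x y → Cl R (a ⊙ x) (b ⊙ y)
    ⊕-assoc    : ∀ {x y z} → Cl R ((x ⊕ y) ⊕ z) (x ⊕ (y ⊕ z))
    ⊕-comm     : ∀ {x y} → Cl R (x ⊕ y) (y ⊕ x)
    ⊕-identity : ∀ {x} → Cl R (𝟘 ⊕ x) x
    ⊕-inverse  : ∀ {x} → Cl R (x ⊕ (-ₖ 1ₖ) ⊙ x) 𝟘
    ⊙-assoc    : ∀ {a b x} → Cl R ((a *ₖ b) ⊙ x) (a ⊙ (b ⊙ x))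
    ⊙-identity : ∀ {x} → Cl R (1ₖ ⊙ x) x
    ⊙-distribˡ : ∀ {a x y} → Cl R (a ⊙ (x ⊕ y)) (a ⊙ x ⊕ a ⊙ y)
    ⊙-distribʳ : ∀ {a b x} → Cl R ((a +ₖ b) ⊙ x) (a ⊙ x ⊕ b ⊙ x)

  ext : ∀ {g h} {G : Set g} {H : Set h} → (G → Term H) → Term G → Term H
  ext f (gen x) = f x
  ext f 𝟘       = 𝟘
  ext f (x ⊕ y) = ext f x ⊕ ext f y
  ext f (a ⊙ x) = a ⊙ ext f x

  extₖ : ∀ {g} {G : Set g} → (G → 𝕂) → Term G → 𝕂
  extₖ f (gen x) = f x
  extₖ f 𝟘       = 0ₖ
  extₖ f (x ⊕ y) = extₖ f x +ₖ extₖ f y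
  extₖ f (a ⊙ x) = a *ₖ extₖ f x

  mapT : ∀ {g h} {G : Set g} {H : Set h} → (G → H) → Term G → Term H
  mapT f = ext (λ x → gen (f x))

  sumT : ∀ {g} {G : Set g} → List (Term G) → Term G
  sumT = foldr _⊕_ 𝟘

  _⊗ₜ_ : ∀ {g h} {G : Set g} {H : Set h} → Term G → Term H → Term (G × H)
  x ⊗ₜ y = ext (λ a → ext (λ b → gen (a , b)) y) x

  -- Tensor product of presented modules:  ⟨G | R⟩ ⊗ ⟨H | S⟩ = ⟨G × H | R ⊗ H, G ⊗ S⟩
  data _⊗ᴿ_ {g h r s} {G : Set g} {H : Set h}
            (R : Term G → Term G → Set r) (S : Term H → Term H → Set s)
            : Term (G × H) → Term (G × H) → Set (c ⊔ g ⊔ h ⊔ r ⊔ s) where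
    left  : ∀ {x y} → R x y → (b : H) → (R ⊗ᴿ S) (mapT (λ a → (a , b)) x) (mapT (λ a → (a , b)) y)
    right : ∀ {x y} → (a : G) → S x y → (R ⊗ᴿ S) (mapT (λ b → (a , b)) x) (mapT (λ b → (a , b)) y)

  -- 𝓕(V) = ⊕ₙ V^{⊗n} ⊗ 𝕂𝔖ₙ, presented by generators (v₁⊗⋯⊗vₙ) # σ
  -- (n ∈ ℕ, v ∈ Vⁿ, σ ∈ 𝔖ₙ) and the relations of multilinearity in the
  -- vᵢ (and compatibility with the equality of V).

  GenF : Set m
  GenF = Σ[ n ∈ ℕ ] ((Fin n → Carrierᴹ) × Perm n)

  deg : GenF → ℕ
  deg = proj₁

  _[_]≔_ : ∀ {n} → (Fin n → Carrierᴹ) → Fin n → Carrierᴹ → Fin n → Carrierᴹ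
  (v [ i ]≔ x) j with i ≟ᶠ j
  ... | yes _ = x
  ... | no  _ = v j

  data RelF : Term GenF → Term GenF → Set (c ⊔ m ⊔ ℓm) where
    multilinear : ∀ {n} (v : Fin n → Carrierᴹ) (σ : Perm n) (i : Fin n) (a : 𝕂) (x y : Carrierᴹ) →
      RelF (gen (n , (v [ i ]≔ (a *ₗ x +ᴹ y)) , σ))
           (a ⊙ gen (n , (v [ i ]≔ x) , σ) ⊕ gen (n , (v [ i ]≔ y) , σ))
    respects-≈ : ∀ {n} (v w : Fin n → Carrierᴹ) (σ : Perm n) → (∀ i → v i ≈ᴹ w i) →
      RelF (gen (n , v , σ)) (gen (n , w , σ))

  RelFF  = RelF ⊗ᴿ RelF
  RelFFF = RelF ⊗ᴿ RelFF

  _≈F_ : Term GenF → Term GenF → Set _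
  _≈F_ = Cl RelF

  _≈FF_ : Term (GenF × GenF) → Term (GenF × GenF) → Set _
  _≈FF_ = Cl RelFF

  _≈FFF_ : Term (GenF × (GenF × GenF)) → Term (GenF × (GenF × GenF)) → Set _
  _≈FFF_ = Cl RelFFF

  act : ∀ {n} → Perm n → (Fin n → Carrierᴹ) → Perm n → Term GenF
  act {n} π v σ = gen (n , (λ i → v (decode (invₚ π) i)) , (π ∘ₚ σ))

  𝟙 : GenF
  𝟙 = (0 , (λ ()) , [])

  unit : 𝕂 → Term GenF
  unit a = a ⊙ gen 𝟙

  mulG : GenF → GenF → Term GenF
  mulG (n , v , σ) (n' , v' , σ') =
    sumT (List.map (λ π → act π (v ++ᵛ v') (σ ×ₚ σ')) (shuffles n n'))

  mul : Term (GenF × GenF) → Term GenF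
  mul = ext (λ p → mulG (proj₁ p) (proj₂ p))

  _*_ : Term GenF → Term GenF → Term GenF
  x * y = mul (x ⊗ₜ y)

  splits : ∀ n → List (Σ[ p ∈ ℕ ] Σ[ q ∈ ℕ ] (p + q ≡ n))
  splits n = List.map (λ (i : Fin (suc n)) → toℕ i , n ∸ toℕ i , m+[n∸m]≡n (toℕ≤pred[n] i))
                      (allFin (suc n))

  coprodG : GenF → Term (GenF × GenF)
  coprodG (n , v , σ) = sumT (List.map piece (splits n))
    where
    piece : Σ[ p ∈ ℕ ] Σ[ q ∈ ℕ ] (p + q ≡ n) → Term (GenF × GenF)
    piece (p , q , eq) =
      gen ( (p , (λ j → v (cast eq (j Fin.↑ˡ q))) , πₚ)
          , (q , (λ j → v (cast eq (p Fin.↑ʳ j))) , π'ₚ) )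
      where
      w  : Fin p → Fin n
      w j = decode (invₚ σ) (cast eq (j Fin.↑ˡ q))
      w' : Fin q → Fin n
      w' j = decode (invₚ σ) (cast eq (p Fin.↑ʳ j))
      πₚ : Perm p
      πₚ = encode (inv (std w))
      π'ₚ : Perm q
      π'ₚ = encode (inv (std w'))

  Δ : Term GenF → Term (GenF × GenF)
  Δ = ext coprodG

  εG : GenF → 𝕂
  εG (zero , _ , _)  = 1ₖ
  εG (suc _ , _ , _) = 0ₖ

  ε : Term GenF → 𝕂
  ε = extₖ εG

  Δ⊗id∘Δ : Term GenF → Term (GenF × (GenF × GenF))
  Δ⊗id∘Δ x = ext (λ p → mapT (λ q → (proj₁ (proj₁ q) , (proj₂ (proj₁ q) , proj₂ q)))
                                   (coprodG (proj₁ p) ⊗ₜ gen (proj₂ p)))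
                 (Δ x)

  id⊗Δ∘Δ : Term GenF → Term (GenF × (GenF × GenF))
  id⊗Δ∘Δ x = ext (λ p → gen (proj₁ p) ⊗ₜ coprodG (proj₂ p)) (Δ x)

  -- (ε ⊗ id) ∘ Δ and (id ⊗ ε) ∘ Δ, composed with 𝕂 ⊗ 𝓕 ≅ 𝓕 ≅ 𝓕 ⊗ 𝕂
  ε⊗id∘Δ : Term GenF → Term GenF
  ε⊗id∘Δ x = ext (λ p → εG (proj₁ p) ⊙ gen (proj₂ p)) (Δ x)

  id⊗ε∘Δ : Term GenF → Term GenF
  id⊗ε∘Δ x = ext (λ p → εG (proj₂ p) ⊙ gen (proj₁ p)) (Δ x)

  _*₂_ : Term (GenF × GenF) → Term (GenF × GenF) → Term (GenF × GenF)
  x *₂ y = ext (λ q → mulG (proj₁ (proj₁ q)) (proj₁ (proj₂ q))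
                       ⊗ₜ mulG (proj₂ (proj₁ q)) (proj₂ (proj₂ q)))
               (x ⊗ₜ y)

  data Homog (d : ℕ) : Term GenF → Set (c ⊔ m) where
    gen : ∀ g → deg g ≡ d → Homog d (gen g)
    𝟘   : Homog d 𝟘
    _⊕_ : ∀ {x y} → Homog d x → Homog d y → Homog d (x ⊕ y)
    _⊙_ : ∀ a {x} → Homog d x → Homog d (a ⊙ x)

  data Homog₂ (d : ℕ) : Term (GenF × GenF) → Set (c ⊔ m) where
    gen : ∀ g h → deg g + deg h ≡ d → Homog₂ d (gen (g , h))
    𝟘   : Homog₂ d 𝟘
    _⊕_ : ∀ {x y} → Homog₂ d x → Homog₂ d y → Homog₂ d (x ⊕ y)
    _⊙_ : ∀ a {x} → Homog₂ d x → Homog₂ d (a ⊙ x)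

  record IsGradedBialgebra : Set (c ⊔ ℓ ⊔ m ⊔ ℓm) where
    field
      *-cong  : ∀ {x y} → x ≈FF y → mul x ≈F mul y
      Δ-cong  : ∀ {x y} → x ≈F y → Δ x ≈FF Δ y
      ε-cong  : ∀ {x y} → x ≈F y → ε x ≈ₖ ε y
      *-assoc     : ∀ x y z → (x * y) * z ≈F x * (y * z)
      *-identityˡ : ∀ x → unit 1ₖ * x ≈F x
      *-identityʳ : ∀ x → x * unit 1ₖ ≈F x
      Δ-coassoc   : ∀ x → Δ⊗id∘Δ x ≈FFF id⊗Δ∘Δ x
      ε-counitˡ   : ∀ x → ε⊗id∘Δ x ≈F x
      ε-counitʳ   : ∀ x → id⊗ε∘Δ x ≈F x
      Δ-*         : ∀ x y → Δ (x * y) ≈FF (Δ x *₂ Δ y)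
      Δ-unit      : Δ (unit 1ₖ) ≈FF gen (𝟙 , 𝟙)
      ε-*         : ∀ x y → ε (x * y) ≈ₖ (ε x *ₖ ε y)
      ε-unit      : ε (unit 1ₖ) ≈ₖ 1ₖ
      *-graded    : ∀ g h → Homog (deg g + deg h) (mulG g h)
      Δ-graded    : ∀ g → Homog₂ (deg g) (coprodG g)
      unit-graded : Homog 0 (gen 𝟙)
      ε-graded    : ∀ g → ¬ (deg g ≡ 0) → εG g ≈ₖ 0ₖ

{-# OPTIONS --safe #-}

-- Reading (v₁⊗⋯⊗vₙ)#σ as the word with letters vᵢ labelled by σ⁻¹(i), the
-- product becomes the shuffle product and the coproduct deconcatenation, both
-- followed by standardization of the labels.  A generator therefore depends
-- only on the relative order of the labels of a word spelling it.  If the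
-- words spelling the factors are chosen with all labels of the first factor
-- below those of the second, no relabelling is needed along the way, and the
-- bialgebra axioms reduce to those of the shuffle algebra on plain words.

module Submission where

open import Defs
open import Algebra.Bundles using (CommutativeMonoid; CommutativeRing)
open import Algebra.Module.Bundles using (Module)
import Algebra.Properties.CommutativeSemigroup as CommutativeSemigroupProperties
import Algebra.Properties.Ring as RingProperties
open import Data.Empty using (⊥-elim)
open import Data.Fin as Fin using (Fin; zero; suc; toℕ; splitAt; punchIn; punchOut; cast; _↑ˡ_; _↑ʳ_)
import Data.Fin.Properties as Fin
open import Data.List as List using (List; []; _∷_; _++_; filter; allFin; length; tabulate; map)
open import Data.List.Membership.Propositional using (_∈_)
open import Data.List.Membership.Propositional.Properties
  using (∈-allFin; ∈-concatMap⁺; ∈-filter⁺; ∈-filter⁻; ∈-lookup; ∈-map⁺; ∈-map⁻;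
         ∈-tabulate⁺; ∈-tabulate⁻; ∈-++⁺ˡ; ∈-++⁺ʳ; ∈-++⁻)
open import Data.List.Membership.Propositional.Properties.WithK using (unique∧set⇒bag)
import Data.List.Properties as List
open import Data.List.Relation.Binary.BagAndSetEquality using (∼bag⇒↭)
open import Data.List.Relation.Binary.Disjoint.Propositional using (Disjoint)
open import Data.List.Relation.Binary.Permutation.Propositional as Permutation
  using (_↭_; ↭-sym; ↭⇒↭ₛ)
import Data.List.Relation.Binary.Permutation.Propositional.Properties as ↭
import Data.List.Relation.Binary.Permutation.Setoid.Properties as ↭ₛ
open import Data.List.Relation.Ternary.Interleaving.Propositional as Interleaving
  using (Interleaving; []; _∷ˡ_; _∷ʳ_; consˡ; consʳ; toPermutation)
open import Data.List.Relation.Unary.All as All using ([]; _∷_)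
import Data.List.Relation.Unary.All.Properties as All
open import Data.List.Relation.Unary.AllPairs as AllPairs using (AllPairs; []; _∷_)
import Data.List.Relation.Unary.AllPairs.Properties as AllPairs
open import Data.List.Relation.Unary.Any as Any using (here; there)
open import Data.List.Relation.Unary.Unique.Propositional using (Unique)
import Data.List.Relation.Unary.Unique.Propositional.Properties as Unique
open import Data.Nat as ℕ using (ℕ; zero; suc; _+_; _∸_)
import Data.Nat.Properties as ℕ
open import Data.Product using (Σ-syntax; ∃; _×_; _,_; proj₁; proj₂)
open import Data.Sum using (_⊎_; inj₁; inj₂; [_,_]′)
open import Data.Vec.Functional using () renaming (_++_ to _++ᵛ_)
open import Function using (_∘_; Injective; mk⇔)
open import Relation.Binary using (tri<; tri≈; tri>)
open import Relation.Binary.PropositionalEquality as ≡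
  using (_≡_; _≢_; _≗_; refl; sym; trans; cong; cong₂; subst; subst₂)
import Relation.Binary.Reasoning.Setoid as ≈-Reasoning
open import Relation.Nullary using (Dec; yes; no; contradiction)
open import Relation.Nullary.Decidable using (_×-dec_)

-- Labels are read from σ⁻¹ because `act π` replaces v by v ∘ π⁻¹ and σ by πσ, and (πσ)⁻¹ = σ⁻¹ ∘
-- π⁻¹. Vector and label at a position therefore travel together, and π merely transports letters.
-- The requirement that one word lie below the other mirrors `σ ×ₚ σ'`, which lifts the second block
-- above the first. Labels may lie in any `Fin N`, so that a part of a word is again a word. Three
-- obstacles shape the rest. `shuffles` filters an enumeration of all permutations, while the word
-- identities are inductions on letters; the two sides are matched as multisets, which suffices for
-- sums in a commutative monoid. `encode` and `inv` are total functions that are meaningful only on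
-- injective arguments, so injectivity is carried along everywhere. Finally, vectors are functions,
-- for which pointwise agreement gives only `≈F`; a generator is thus recovered from its word up to
-- `≈F`, not up to `≡`.

Inj : ∀ {a b} {A : Set a} {B : Set b} → (A → B) → Set _
Inj = Injective _≡_ _≡_

-- Permutation codes and their inverses

∷-injective : ∀ {n} {i j : Fin (suc n)} {c d : Perm n} → i ∷ c ≡ j ∷ d → i ≡ j × c ≡ d
∷-injective refl = refl , refl

decode-Inj : ∀ {n} (c : Perm n) → Inj (decode c)
decode-Inj (i ∷ c) {zero}  {zero}  _ = refl
decode-Inj (i ∷ c) {zero}  {suc k} e = ⊥-elim (Fin.punchInᵢ≢i i _ (sym e))
decode-Inj (i ∷ c) {suc j} {zero}  e = ⊥-elim (Fin.punchInᵢ≢i i _ e)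
decode-Inj (i ∷ c) {suc j} {suc k} e = cong suc (decode-Inj c (Fin.punchIn-injective i _ _ e))

decode-faithful : ∀ {n} (c d : Perm n) → decode c ≗ decode d → c ≡ d
decode-faithful []      []      _ = refl
decode-faithful (i ∷ c) (j ∷ d) e with e zero
... | refl = cong (i ∷_) (decode-faithful c d (λ k → Fin.punchIn-injective i _ _ (e (suc k))))

punchIn-pout : ∀ {n} (i k : Fin (suc (suc n))) → k ≢ i → punchIn i (pout i k) ≡ k
punchIn-pout zero    zero    k≢i = ⊥-elim (k≢i refl)
punchIn-pout zero    (suc k) _   = refl
punchIn-pout {zero}  (suc i) zero    _ = refl
punchIn-pout {zero}  (suc zero) (suc zero) k≢i = ⊥-elim (k≢i refl)
punchIn-pout {suc n} (suc i) zero    _ = refl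
punchIn-pout {suc n} (suc i) (suc k) k≢i = cong suc (punchIn-pout i k (k≢i ∘ cong suc))

-- Injectivity keeps `f (suc j)` away from `f zero`, the only argument at which `pout` is arbitrary.
-- The punched-out remainder is therefore injective again, and the induction continues.
decode-encode : ∀ {n} {f : Fin n → Fin n} → Inj f → decode (encode f) ≗ f
decode-encode {suc zero}        _ zero = refl
decode-encode {suc (suc n)}     _ zero = refl
decode-encode {suc (suc n)} {f} f-inj (suc j) =
  trans (cong (punchIn (f zero)) (decode-encode g-inj j)) (section j)
  where
  section : ∀ j → punchIn (f zero) (pout (f zero) (f (suc j))) ≡ f (suc j)
  section j = punchIn-pout (f zero) (f (suc j)) λ e → Fin.0≢1+n (sym (f-inj e))
  g-inj : Inj (λ j → pout (f zero) (f (suc j)))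
  g-inj {j} {k} e = Fin.suc-injective (f-inj
    (trans (sym (section j)) (trans (cong (punchIn (f zero)) e) (section k))))

-- Pigeonhole: a missed value could be punched out, which would inject `Fin (suc n)` into `Fin n`.
Inj⇒surjective : ∀ {n} {f : Fin n → Fin n} → Inj f → ∀ j → ∃ λ i → f i ≡ j
Inj⇒surjective {suc n} {f} f-inj j with Fin.any? (λ i → f i Fin.≟ j)
... | yes p = p
... | no ¬p = contradiction
  (Fin.injective⇒≤ {f = λ i → punchOut {i = j} {j = f i} (λ e → ¬p (i , sym e))}
    (λ e → f-inj (Fin.punchOut-injective {i = j} _ _ e)))
  (ℕ.<⇒≱ ℕ.≤-refl)

inv-inverseʳ : ∀ {n} {f : Fin n → Fin n} → Inj f → ∀ j → f (inv f j) ≡ j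
inv-inverseʳ {f = f} f-inj j with Fin.any? (λ i → f i Fin.≟ j)
... | yes (_ , p) = p
... | no ¬p       = ⊥-elim (¬p (Inj⇒surjective f-inj j))

inv-Inj : ∀ {n} {f : Fin n → Fin n} → Inj f → Inj (inv f)
inv-Inj {f = f} f-inj {i} {j} e =
  trans (sym (inv-inverseʳ f-inj i)) (trans (cong f e) (inv-inverseʳ f-inj j))

decode⁻¹ : ∀ {n} → Perm n → Fin n → Fin n
decode⁻¹ σ = decode (invₚ σ)

decode⁻¹-Inj : ∀ {n} (σ : Perm n) → Inj (decode⁻¹ σ)
decode⁻¹-Inj σ = decode-Inj (invₚ σ)

inverseʳ : ∀ {n} (σ : Perm n) i → decode σ (decode⁻¹ σ i) ≡ i
inverseʳ σ i = trans (cong (decode σ) (decode-encode (inv-Inj (decode-Inj σ)) i))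
                     (inv-inverseʳ (decode-Inj σ) i)

inverseˡ : ∀ {n} (σ : Perm n) i → decode⁻¹ σ (decode σ i) ≡ i
inverseˡ σ i = decode-Inj σ (inverseʳ σ (decode σ i))

decode⁻¹-unique : ∀ {n} (σ : Perm n) {i j} → decode σ j ≡ i → decode⁻¹ σ i ≡ j
decode⁻¹-unique σ e = trans (cong (decode⁻¹ σ) (sym e)) (inverseˡ σ _)

-- The coproduct stores its permutations as `encode (inv (std w))`; this recovers `std w` as the
-- word of labels.
decode⁻¹-encode-inv : ∀ {n} {f : Fin n → Fin n} → Inj f → decode⁻¹ (encode (inv f)) ≗ f
decode⁻¹-encode-inv {f = f} f-inj i = decode⁻¹-unique (encode (inv f))
  (trans (decode-encode (inv-Inj f-inj) (f i)) (f-inj (inv-inverseʳ f-inj (f i))))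

decode-∘ₚ : ∀ {n} (π σ : Perm n) i → decode (π ∘ₚ σ) i ≡ decode π (decode σ i)
decode-∘ₚ π σ = decode-encode (decode-Inj σ ∘ decode-Inj π)

decode⁻¹-∘ₚ : ∀ {n} (π σ : Perm n) i → decode⁻¹ (π ∘ₚ σ) i ≡ decode⁻¹ σ (decode⁻¹ π i)
decode⁻¹-∘ₚ π σ i = decode⁻¹-unique (π ∘ₚ σ)
  (trans (decode-∘ₚ π σ _) (trans (cong (decode π) (inverseʳ σ _)) (inverseʳ π i)))

data SplitView (n m : ℕ) : Fin (n + m) → Set where
  fromˡ : ∀ i → SplitView n m (i ↑ˡ m)
  fromʳ : ∀ j → SplitView n m (n ↑ʳ j)

splitView : ∀ n m (a : Fin (n + m)) → SplitView n m a
splitView zero    m a       = fromʳ a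
splitView (suc n) m zero    = fromˡ zero
splitView (suc n) m (suc a) with splitView n m a
... | fromˡ i = fromˡ (suc i)
... | fromʳ j = fromʳ j

↑ˡ≢↑ʳ : ∀ {n m} {i : Fin n} {j : Fin m} → i ↑ˡ m ≢ n ↑ʳ j
↑ˡ≢↑ʳ {i = suc i} e = ↑ˡ≢↑ʳ {i = i} (Fin.suc-injective e)

module _ {n m} (σ : Perm n) (τ : Perm m) where
  private
    block : Fin (n + m) → Fin (n + m)
    block a = [ (λ i → decode σ i ↑ˡ m) , (λ j → n ↑ʳ decode τ j) ]′ (splitAt n a)

    block-↑ˡ : ∀ i → block (i ↑ˡ m) ≡ decode σ i ↑ˡ m
    block-↑ˡ i = cong [ _ , _ ]′ (Fin.splitAt-↑ˡ n i m)

    block-↑ʳ : ∀ j → block (n ↑ʳ j) ≡ n ↑ʳ decode τ j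
    block-↑ʳ j = cong [ _ , _ ]′ (Fin.splitAt-↑ʳ n m j)

    block-Inj : Inj block
    block-Inj {a} {b} e with splitView n m a | splitView n m b
    ... | fromˡ i | fromˡ j rewrite block-↑ˡ i | block-↑ˡ j =
      cong (_↑ˡ m) (decode-Inj σ (Fin.↑ˡ-injective m _ _ e))
    ... | fromˡ i | fromʳ j rewrite block-↑ˡ i | block-↑ʳ j = ⊥-elim (↑ˡ≢↑ʳ e)
    ... | fromʳ i | fromˡ j rewrite block-↑ʳ i | block-↑ˡ j = ⊥-elim (↑ˡ≢↑ʳ (sym e))
    ... | fromʳ i | fromʳ j rewrite block-↑ʳ i | block-↑ʳ j =
      cong (n ↑ʳ_) (decode-Inj τ (Fin.↑ʳ-injective n _ _ e))

  decode⁻¹-×ₚ-↑ˡ : ∀ i → decode⁻¹ (σ ×ₚ τ) (i ↑ˡ m) ≡ decode⁻¹ σ i ↑ˡ m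
  decode⁻¹-×ₚ-↑ˡ i = decode⁻¹-unique (σ ×ₚ τ) (trans (decode-encode block-Inj _)
    (trans (block-↑ˡ _) (cong (_↑ˡ m) (inverseʳ σ i))))

  decode⁻¹-×ₚ-↑ʳ : ∀ j → decode⁻¹ (σ ×ₚ τ) (n ↑ʳ j) ≡ n ↑ʳ decode⁻¹ τ j
  decode⁻¹-×ₚ-↑ʳ j = decode⁻¹-unique (σ ×ₚ τ) (trans (decode-encode block-Inj _)
    (trans (block-↑ʳ _) (cong (n ↑ʳ_) (inverseʳ τ j))))

-- For injective f: the standardization of the word f is σ⁻¹.
Sorts : ∀ {n N} → (Fin n → Fin N) → Perm n → Set
Sorts f σ = ∀ {i j} → f i Fin.< f j → decode⁻¹ σ i Fin.< decode⁻¹ σ j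

-- The predecessor of `suc i` is `inject₁ i`, so the induction runs on `h ∘ inject₁`; strictness of
-- the last step gains the missing one.
strict-mono⇒≤ : ∀ {n m} {h : Fin n → Fin m} → (∀ {i j} → i Fin.< j → h i Fin.< h j) →
                ∀ i → toℕ i ℕ.≤ toℕ (h i)
strict-mono⇒≤ h-mono zero    = ℕ.z≤n
strict-mono⇒≤ {h = h} h-mono (suc i) = ℕ.≤-trans
  (ℕ.s≤s (strict-mono⇒≤ {h = λ k → h (Fin.inject₁ k)}
     (λ {a} {b} a<b → h-mono (subst₂ ℕ._<_ (sym (Fin.toℕ-inject₁ a)) (sym (Fin.toℕ-inject₁ b)) a<b)) i))
  (h-mono (subst (ℕ._< suc (toℕ i)) (sym (Fin.toℕ-inject₁ i)) ℕ.≤-refl))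

-- Both inverses order positions as f does, so τ⁻¹σ and σ⁻¹τ are strictly increasing. Each dominates
-- the identity, and being mutually inverse they are the identity.
Sorts-unique : ∀ {n N} {f : Fin n → Fin N} (σ τ : Perm n) → Inj f → Sorts f σ → Sorts f τ → σ ≡ τ
Sorts-unique {f = f} σ τ f-inj σ-sorts τ-sorts = decode-faithful σ τ λ i →
  trans (sym (inverseʳ τ (decode σ i))) (cong (decode τ) (fixed i))
  where
  mono : ∀ σ τ → Sorts f σ → Sorts f τ → ∀ {i j} → i Fin.< j →
         decode⁻¹ τ (decode σ i) Fin.< decode⁻¹ τ (decode σ j)
  mono σ τ σ-sorts τ-sorts {i} {j} i<j with Fin.<-cmp (f (decode σ i)) (f (decode σ j))
  ... | tri< lt _ _ = τ-sorts lt
  ... | tri≈ _ eq _ = ⊥-elim (ℕ.<-irrefl (cong toℕ (decode-Inj σ (f-inj eq))) i<j)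
  ... | tri> _ _ gt = ⊥-elim (ℕ.<-asym i<j
          (subst₂ Fin._<_ (inverseˡ σ j) (inverseˡ σ i) (σ-sorts gt)))
  fixed : ∀ i → decode⁻¹ τ (decode σ i) ≡ i
  fixed i = Fin.toℕ-injective (ℕ.≤-antisym
    (subst (decode⁻¹ τ (decode σ i) Fin.≤_)
      (trans (cong (decode⁻¹ σ) (inverseʳ τ (decode σ i))) (inverseˡ σ i))
      (strict-mono⇒≤ (mono τ σ τ-sorts σ-sorts) (decode⁻¹ τ (decode σ i))))
    (strict-mono⇒≤ (mono σ τ σ-sorts τ-sorts) i))

allPerms-complete : ∀ {n} (σ : Perm n) → σ ∈ allPerms n
allPerms-complete []      = here refl
allPerms-complete (i ∷ c) = ∈-concatMap⁺ (λ i → List.map (i ∷_) (allPerms _))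
  (Any.map (λ { refl → ∈-map⁺ (i ∷_) (allPerms-complete c) }) (∈-allFin i))

allPerms-unique : ∀ n → Unique (allPerms n)
allPerms-unique zero    = [] ∷ []
allPerms-unique (suc n) = Unique.concat⁺
  (All.map⁺ (All.tabulate λ _ → Unique.map⁺ (proj₂ ∘ ∷-injective) (allPerms-unique n)))
  (AllPairs.map⁺ (AllPairs.map
    (λ i≢j {_} pq → i≢j (heads (proj₁ pq) (proj₂ pq))) (Unique.allFin⁺ (suc n))))
  where
  heads : ∀ {i j σ} → σ ∈ List.map (i ∷_) (allPerms n) → σ ∈ List.map (j ∷_) (allPerms n) → i ≡ j
  heads {i} {j} p q with ∈-map⁻ (i ∷_) p | ∈-map⁻ (j ∷_) q
  ... | _ , _ , refl | _ , _ , e = proj₁ (∷-injective e)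

-- Standardization of injective words

filter-filter : ∀ {a p q} {A : Set a} {P : A → Set p} {Q : A → Set q}
                (P? : ∀ x → Dec (P x)) (Q? : ∀ x → Dec (Q x)) → (∀ {x} → P x → Q x) →
                ∀ xs → filter P? (filter Q? xs) ≡ filter P? xs
filter-filter P? Q? P⇒Q []       = refl
filter-filter P? Q? P⇒Q (x ∷ xs) with Q? x
... | no ¬q = trans (filter-filter P? Q? P⇒Q xs) (sym (List.filter-reject P? (¬q ∘ P⇒Q)))
... | yes _ with P? x
...   | yes _ = cong (x ∷_) (filter-filter P? Q? P⇒Q xs)
...   | no  _ = filter-filter P? Q? P⇒Q xs

module _ {k N} {w : Fin k → Fin N} (w-inj : Inj w) where
  private
    below : ∀ i (j : Fin k) → Dec (w j Fin.< w i)
    below i j = w j Fin.<? w i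

    rank : Fin k → ℕ
    rank i = countᵈ (below i)

    rank<k : ∀ i → rank i ℕ.< k
    rank<k i = subst (rank i ℕ.<_) (List.length-tabulate (λ j → j))
      (List.filter-notAll (below i) (allFin k)
        (Any.map (λ { refl → ℕ.<-irrefl refl }) (∈-allFin i)))

    no-ties : ∀ i → countᵈ (λ j → (j Fin.<? i) ×-dec (w j Fin.≟ w i)) ≡ 0
    no-ties i = cong length (List.filter-none (λ j → (j Fin.<? i) ×-dec (w j Fin.≟ w i))
      {allFin k} (All.tabulate λ { _ (j<i , e) → ℕ.<-irrefl (cong toℕ (w-inj e)) j<i }))

    -- Without repeated letters the tie count vanishes, and the rank stays below k because i is
    -- never below itself; so `clamp` does not fall back on its default.
    toℕ-std : ∀ i → toℕ (std w i) ≡ rank i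
    toℕ-std i rewrite no-ties i | ℕ.+-identityʳ (rank i) with rank i ℕ.<? k
    ... | yes r<k = Fin.toℕ-fromℕ< r<k
    ... | no  r≮k = ⊥-elim (r≮k (rank<k i))

    -- Whatever lies below `w i` lies below `w j`, and `w i` itself is counted for j only, which
    -- makes the inequality strict.
    rank-mono : ∀ {i j} → w i Fin.< w j → rank i ℕ.< rank j
    rank-mono {i} {j} wi<wj = subst (ℕ._< rank j)
      (cong length (filter-filter (below i) (below j) (λ lt → ℕ.<-trans lt wi<wj) (allFin k)))
      (List.filter-notAll (below i) (filter (below j) (allFin k))
        (Any.map (λ { refl → ℕ.<-irrefl refl }) (∈-filter⁺ (below j) (∈-allFin i) wi<wj)))

  std-mono : ∀ {i j} → w i Fin.< w j → std w i Fin.< std w j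
  std-mono lt = subst₂ ℕ._<_ (sym (toℕ-std _)) (sym (toℕ-std _)) (rank-mono lt)

  std-Inj : Inj (std w)
  std-Inj {i} {j} e with Fin.<-cmp (w i) (w j)
  ... | tri< lt _ _ = ⊥-elim (ℕ.<-irrefl (cong toℕ e) (std-mono lt))
  ... | tri≈ _ eq _ = w-inj eq
  ... | tri> _ _ gt = ⊥-elim (ℕ.<-irrefl (cong toℕ (sym e)) (std-mono gt))

  std-Sorts : Sorts w (encode (inv (std w)))
  std-Sorts lt = subst₂ Fin._<_ (sym (decode⁻¹-encode-inv std-Inj _))
    (sym (decode⁻¹-encode-inv std-Inj _)) (std-mono lt)

-- Shuffles

Mono : ∀ {n l} → (Fin n → Fin l) → Set
Mono h = ∀ {i j} → i Fin.< j → h i Fin.< h j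

module _ {a} {A : Set a} where

  shuf : List A → List A → List (List A)
  shuf []       ys       = ys ∷ []
  shuf (x ∷ xs) []       = (x ∷ xs) ∷ []
  shuf (x ∷ xs) (y ∷ ys) = map (x ∷_) (shuf xs (y ∷ ys)) ++ map (y ∷_) (shuf (x ∷ xs) ys)

  interleavingʳ : ∀ {ys u : List A} → Interleaving [] ys u → u ≡ ys
  interleavingʳ []        = refl
  interleavingʳ (consʳ s) = cong (_ ∷_) (interleavingʳ s)

  interleavingˡ : ∀ {xs u : List A} → Interleaving xs [] u → u ≡ xs
  interleavingˡ []        = refl
  interleavingˡ (consˡ s) = cong (_ ∷_) (interleavingˡ s)

  ∈-shuf⁺ : ∀ {xs ys u} → Interleaving xs ys u → u ∈ shuf xs ys
  ∈-shuf⁺ {[]}     {ys}     s         = here (interleavingʳ s)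
  ∈-shuf⁺ {x ∷ xs} {[]}     s         = here (interleavingˡ s)
  ∈-shuf⁺ {x ∷ xs} {y ∷ ys} (consˡ s) = ∈-++⁺ˡ (∈-map⁺ (x ∷_) (∈-shuf⁺ s))
  ∈-shuf⁺ {x ∷ xs} {y ∷ ys} (consʳ s) =
    ∈-++⁺ʳ (map (x ∷_) (shuf xs (y ∷ ys))) (∈-map⁺ (y ∷_) (∈-shuf⁺ s))

  ∈-shuf⁻ : ∀ xs ys {u} → u ∈ shuf xs ys → Interleaving xs ys u
  ∈-shuf⁻ []       []       (here refl) = []
  ∈-shuf⁻ []       (y ∷ ys) (here refl) = consʳ (∈-shuf⁻ [] ys (here refl))
  ∈-shuf⁻ (x ∷ [])      []  (here refl) = consˡ []
  ∈-shuf⁻ (x ∷ x' ∷ xs) []  (here refl) = consˡ (∈-shuf⁻ (x' ∷ xs) [] (here refl))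
  ∈-shuf⁻ (x ∷ xs) (y ∷ ys) u∈ with ∈-++⁻ (map (x ∷_) (shuf xs (y ∷ ys))) u∈
  ... | inj₁ p with ∈-map⁻ (x ∷_) p
  ...   | _ , v∈ , refl = consˡ (∈-shuf⁻ xs (y ∷ ys) v∈)
  ∈-shuf⁻ (x ∷ xs) (y ∷ ys) u∈ | inj₂ p with ∈-map⁻ (y ∷_) p
  ...   | _ , v∈ , refl = consʳ (∈-shuf⁻ (x ∷ xs) ys v∈)

  shuf-unique : ∀ xs ys → Disjoint xs ys → Unique (shuf xs ys)
  shuf-unique []       ys       _   = [] ∷ []
  shuf-unique (x ∷ xs) []       _   = [] ∷ []
  shuf-unique (x ∷ xs) (y ∷ ys) dis = Unique.++⁺
    (Unique.map⁺ List.∷-injectiveʳ (shuf-unique xs (y ∷ ys) λ (p , q) → dis (there p , q)))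
    (Unique.map⁺ List.∷-injectiveʳ (shuf-unique (x ∷ xs) ys λ (p , q) → dis (p , there q)))
    heads-differ
    where
    heads-differ : Disjoint (map (x ∷_) (shuf xs (y ∷ ys))) (map (y ∷_) (shuf (x ∷ xs) ys))
    heads-differ (p , q) with ∈-map⁻ (x ∷_) p | ∈-map⁻ (y ∷_) q
    ... | _ , _ , refl | _ , _ , e = dis (here refl , here (List.∷-injectiveˡ e))

  tabulate-injective : ∀ {n} {f g : Fin n → A} → tabulate f ≡ tabulate g → f ≗ g
  tabulate-injective {suc n} e zero    = List.∷-injectiveˡ e
  tabulate-injective {suc n} e (suc i) = tabulate-injective (List.∷-injectiveʳ e) i

  private
    Covers : ∀ {n m l} → (Fin n → Fin l) → (Fin m → Fin l) → Set
    Covers h k = ∀ p → (∃ λ i → h i ≡ p) ⊎ (∃ λ j → k j ≡ p)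

    -- Shifts a map down by one, so that `interleave` can drop the first position of the target.
    avoid-zero : ∀ {n l} (h : Fin n → Fin (suc l)) → Mono h → (∀ i → h i ≢ zero) →
                 ∃ λ h' → Mono h' × (∀ i → h i ≡ suc (h' i))
    avoid-zero h h-mono h≢0 = h' , (λ lt → ℕ.s<s⁻¹ (subst₂ Fin._<_ (h≡ _) (h≡ _) (h-mono lt))) , h≡
      where
      h' = λ i → punchOut (λ e → h≢0 i (sym e))
      h≡ : ∀ i → h i ≡ suc (h' i)
      h≡ i = sym (Fin.punchIn-punchOut (λ e → h≢0 i (sym e)))

    hits-zero : ∀ {n l} {h : Fin n → Fin (suc l)} → Mono h → ∀ {i} → h i ≡ zero → toℕ i ≡ 0
    hits-zero h-mono {zero}  _ = refl
    hits-zero {h = h} h-mono {suc i} e = ⊥-elim (ℕ.n≮0 (subst (h zero Fin.<_) e (h-mono ℕ.z<s)))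

    mono⇒≢zero : ∀ {n l} {h : Fin (suc n) → Fin (suc l)} → Mono h → ∀ i → h (suc i) ≢ zero
    mono⇒≢zero {h = h} h-mono i e = ℕ.n≮0 (subst (h zero Fin.<_) e (h-mono (ℕ.z<s {toℕ i})))

  -- Turns the description of a shuffle by two increasing embeddings into an inductive one. Position
  -- zero is reached by one of the two maps only, and by monotonicity from its first argument; this
  -- decides which word supplies the head, and both maps then avoid zero.
  interleave : ∀ {l n m} {a : Fin n → A} {b : Fin m → A} {c : Fin l → A}
               (h : Fin n → Fin l) (k : Fin m → Fin l) → Mono h → Mono k →
               (∀ i j → h i ≢ k j) → Covers h k → c ∘ h ≗ a → c ∘ k ≗ b →
               Interleaving (tabulate a) (tabulate b) (tabulate c)
  interleave {zero} {zero}  {zero}  h k _ _ _ _ _ _ = []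
  interleave {zero} {suc n}         h k _ _ _ _ _ _ with () ← h zero
  interleave {zero} {zero}  {suc m} h k _ _ _ _ _ _ with () ← k zero
  interleave {suc l} {n} {m} {a} {b} {c} h k h-mono k-mono h≢k cov ca cb with cov zero
  interleave {suc l} {suc n} {m} {a} {b} {c} h k h-mono k-mono h≢k cov ca cb
    | inj₁ (i , hi≡0) with refl ← Fin.toℕ-injective {j = zero} (hits-zero h-mono hi≡0)
    with h' , h'-mono , h≡ ← avoid-zero (h ∘ suc) (λ lt → h-mono (ℕ.s<s lt)) (mono⇒≢zero h-mono)
    with k' , k'-mono , k≡ ← avoid-zero k k-mono (λ j e → h≢k zero j (trans hi≡0 (sym e))) =
    trans (sym (ca zero)) (cong c hi≡0) ∷ˡ interleave h' k' h'-mono k'-mono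
      (λ i j e → h≢k (suc i) j (trans (h≡ i) (trans (cong suc e) (sym (k≡ j))))) cov'
      (λ i → trans (cong c (sym (h≡ i))) (ca (suc i))) (λ j → trans (cong c (sym (k≡ j))) (cb j))
    where
    cov' : Covers h' k'
    cov' p with cov (suc p)
    ... | inj₁ (zero  , e) = ⊥-elim (Fin.0≢1+n (trans (sym hi≡0) e))
    ... | inj₁ (suc i , e) = inj₁ (i , Fin.suc-injective (trans (sym (h≡ i)) e))
    ... | inj₂ (j     , e) = inj₂ (j , Fin.suc-injective (trans (sym (k≡ j)) e))
  interleave {suc l} {n} {suc m} {a} {b} {c} h k h-mono k-mono h≢k cov ca cb
    | inj₂ (j , kj≡0) with refl ← Fin.toℕ-injective {j = zero} (hits-zero k-mono kj≡0)
    with k' , k'-mono , k≡ ← avoid-zero (k ∘ suc) (λ lt → k-mono (ℕ.s<s lt)) (mono⇒≢zero k-mono)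
    with h' , h'-mono , h≡ ← avoid-zero h h-mono (λ i e → h≢k i zero (trans e (sym kj≡0))) =
    trans (sym (cb zero)) (cong c kj≡0) ∷ʳ interleave h' k' h'-mono k'-mono
      (λ i j e → h≢k i (suc j) (trans (h≡ i) (trans (cong suc e) (sym (k≡ j))))) cov'
      (λ i → trans (cong c (sym (h≡ i))) (ca i)) (λ j → trans (cong c (sym (k≡ j))) (cb (suc j)))
    where
    cov' : Covers h' k'
    cov' p with cov (suc p)
    ... | inj₁ (i     , e) = inj₁ (i , Fin.suc-injective (trans (sym (h≡ i)) e))
    ... | inj₂ (zero  , e) = ⊥-elim (Fin.0≢1+n (trans (sym kj≡0) e))
    ... | inj₂ (suc j , e) = inj₂ (j , Fin.suc-injective (trans (sym (k≡ j)) e))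

  -- Partial converse of `interleave`: the embedding is read off from the order in which letters are
  -- taken.
  positionsˡ : ∀ {l n ys} {a : Fin n → A} {c : Fin l → A} → Interleaving (tabulate a) ys (tabulate c) →
               ∃ λ (h : Fin n → Fin l) → Mono h × c ∘ h ≗ a
  positionsˡ {n = zero} _ = (λ ()) , (λ { {()} }) , λ ()
  positionsˡ {suc l} {suc n} (a≡c ∷ˡ s) with h , h-mono , e ← positionsˡ s =
    (λ { zero → zero ; (suc i) → suc (h i) }) ,
    (λ { {zero} {suc j} _ → ℕ.z<s ; {suc i} {suc j} lt → ℕ.s<s (h-mono (ℕ.s<s⁻¹ lt)) }) ,
    λ { zero → sym a≡c ; (suc i) → e i }
  positionsˡ {suc l} {suc n} (_ ∷ʳ s) with h , h-mono , e ← positionsˡ s =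
    suc ∘ h , ℕ.s<s ∘ h-mono , e

  positionsʳ : ∀ {l m xs} {b : Fin m → A} {c : Fin l → A} → Interleaving xs (tabulate b) (tabulate c) →
               ∃ λ (k : Fin m → Fin l) → Mono k × c ∘ k ≗ b
  positionsʳ s = positionsˡ (Interleaving.swap s)

-- The map f covers two uses: the identity for words of positions, and `proj₂` for the labels of
-- letters.
lookup-Inj : ∀ {a b} {A : Set a} {B : Set b} (f : A → B) {u : List A} →
             AllPairs (λ x y → f x ≢ f y) u → Inj (f ∘ List.lookup u)
lookup-Inj f (_  ∷ _)  {zero}  {zero}  _ = refl
lookup-Inj f (x∉ ∷ _)  {zero}  {suc j} e = ⊥-elim (All.lookup x∉ (∈-lookup j) e)
lookup-Inj f (x∉ ∷ _)  {suc i} {zero}  e = ⊥-elim (All.lookup x∉ (∈-lookup i) (sym e))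
lookup-Inj f (_  ∷ us) {suc i} {suc j} e = cong suc (lookup-Inj f us e)

-- One-line notation of π⁻¹ rather than of π: the entry at p is the position that π moves to p,
-- which is how `act` rearranges letters. For this word, being increasing on both blocks means being
-- an interleaving of them.
word : ∀ {n} → Perm n → List (Fin n)
word π = tabulate (decode⁻¹ π)

word-injective : ∀ {n} {π ρ : Perm n} → word π ≡ word ρ → π ≡ ρ
word-injective {π = π} {ρ} e = decode-faithful π ρ λ i → decode⁻¹-Inj π (trans (inverseˡ π i)
  (trans (sym (inverseˡ ρ i)) (sym (tabulate-injective e (decode ρ i)))))

module _ (n m : ℕ) where
  lefts rights : List (Fin (n + m))
  lefts  = tabulate (_↑ˡ m)
  rights = tabulate (n ↑ʳ_)

  private
    disjoint : Disjoint lefts rights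
    disjoint (p , q) with ∈-tabulate⁻ p | ∈-tabulate⁻ q
    ... | _ , refl | _ , e = ↑ˡ≢↑ʳ e

    shuffle⇒∈shuf : ∀ {π} → IsShuffle n m π → word π ∈ shuf lefts rights
    shuffle⇒∈shuf {π} (mono-l , mono-r) = ∈-shuf⁺
      (interleave (λ i → decode π (i ↑ˡ m)) (λ j → decode π (n ↑ʳ j))
        (mono-l _ _) (mono-r _ _) (λ i j e → ↑ˡ≢↑ʳ (decode-Inj π e)) covers
        (λ i → inverseˡ π _) (λ j → inverseˡ π _))
      where
      covers : ∀ p → (∃ λ i → decode π (i ↑ˡ m) ≡ p) ⊎ (∃ λ j → decode π (n ↑ʳ j) ≡ p)
      covers p with decode⁻¹ π p | inverseʳ π p
      ... | q | e with splitView n m q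
      ...   | fromˡ i = inj₁ (i , e)
      ...   | fromʳ j = inj₂ (j , e)

    tabulated : ∀ {A : Set} {l} (u : List A) → length u ≡ l → Unique u →
                ∃ λ (c : Fin l → A) → Inj c × u ≡ tabulate c
    tabulated u refl u-unique = List.lookup u , lookup-Inj (λ x → x) u-unique ,
                               sym (List.tabulate-lookup u)

    length-interleaving : ∀ {u} → Interleaving lefts rights u → length u ≡ n + m
    length-interleaving s = trans (↭.↭-length (toPermutation s)) (trans (List.length-++ lefts {rights})
      (cong₂ ℕ._+_ {y = n} {v = m} (List.length-tabulate (_↑ˡ m)) (List.length-tabulate (n ↑ʳ_))))

    unique-interleaving : ∀ {u} → Interleaving lefts rights u → Unique u
    unique-interleaving s = ↭ₛ.Unique-resp-↭ (≡.setoid _) (↭⇒↭ₛ (↭-sym (toPermutation s)))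
      (Unique.++⁺ (Unique.tabulate⁺ (Fin.↑ˡ-injective m _ _))
                  (Unique.tabulate⁺ (Fin.↑ʳ-injective n _ _))
        disjoint)

    -- An interleaving of the two blocks has length n + m and no repetition, so it tabulates an
    -- injection c, and π is c⁻¹. The increasing positions of the left and right letters are the
    -- values of π on the two blocks.
    ∈shuf⇒shuffle : ∀ {u} → u ∈ shuf lefts rights → ∃ λ π → IsShuffle n m π × u ≡ word π
    ∈shuf⇒shuffle u∈ with ∈-shuf⁻ lefts rights u∈
    ... | s with tabulated _ (length-interleaving s) (unique-interleaving s)
    ...   | c , c-inj , refl with positionsˡ s | positionsʳ s
    ...     | h , h-mono , ch | k , k-mono , ck =
      π , ((λ i j lt → subst₂ Fin._<_ (sym (at ch i)) (sym (at ch j)) (h-mono lt)) ,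
           (λ i j lt → subst₂ Fin._<_ (sym (at ck i)) (sym (at ck j)) (k-mono lt))) ,
      List.tabulate-cong (λ i → sym (decode⁻¹-encode-inv c-inj i))
      where
      π = encode (inv c)
      at : ∀ {r} {a : Fin r → Fin (n + m)} {h} → c ∘ h ≗ a → ∀ i → decode π (a i) ≡ h i
      at {h = h} e i = decode⁻¹-Inj π (trans (inverseˡ π _)
        (trans (sym (e i)) (sym (decode⁻¹-encode-inv c-inj (h i)))))

  shuffle⇒↭ : ∀ {π} → π ∈ shuffles n m → word π ↭ lefts ++ rights
  shuffle⇒↭ {π} π∈ = toPermutation (∈-shuf⁻ lefts rights
    (shuffle⇒∈shuf {π} (proj₂ (∈-filter⁻ (isShuffle? n m) {xs = allPerms (n + m)} π∈))))

  -- The two enumerations come in unrelated orders, but both are free of duplicates and have the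
  -- same members.
  words-of-shuffles : map word (shuffles n m) ↭ shuf lefts rights
  words-of-shuffles = ∼bag⇒↭ (unique∧set⇒bag
    (Unique.map⁺ word-injective (Unique.filter⁺ (isShuffle? n m) (allPerms-unique (n + m))))
    (shuf-unique lefts rights disjoint)
    (mk⇔ to from))
    where
    to : ∀ {u} → u ∈ map word (shuffles n m) → u ∈ shuf lefts rights
    to p with ∈-map⁻ word p
    ... | π , π∈ , refl = shuffle⇒∈shuf {π}
      (proj₂ (∈-filter⁻ (isShuffle? n m) {xs = allPerms (n + m)} π∈))
    from : ∀ {u} → u ∈ shuf lefts rights → u ∈ map word (shuffles n m)
    from p with ∈shuf⇒shuffle p
    ... | π , sh , refl = ∈-map⁺ word (∈-filter⁺ (isShuffle? n m) (allPerms-complete π) sh)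

-- Sums over shuffles and deconcatenations

module Sums {c ℓ} (M : CommutativeMonoid c ℓ) where

  open CommutativeMonoid M renaming (refl to ≈-refl; sym to ≈-sym; trans to ≈-trans)
  open CommutativeSemigroupProperties commutativeSemigroup using (interchange)
  open ≈-Reasoning setoid

  sum : List Carrier → Carrier
  sum = List.foldr _∙_ ε

  module _ {a} {A : Set a} where

    sum-cong : ∀ {F G : A → Carrier} xs → (∀ {x} → x ∈ xs → F x ≈ G x) → sum (map F xs) ≈ sum (map G xs)
    sum-cong []       _ = ≈-refl
    sum-cong (x ∷ xs) e = ∙-cong (e (here refl)) (sum-cong xs (e ∘ there))

    sum-++ : ∀ (F : A → Carrier) xs ys → sum (map F (xs ++ ys)) ≈ sum (map F xs) ∙ sum (map F ys)
    sum-++ F []       ys = ≈-sym (identityˡ _)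
    sum-++ F (x ∷ xs) ys = ≈-trans (∙-congˡ (sum-++ F xs ys)) (≈-sym (assoc _ _ _))

    sum-↭ : ∀ (F : A → Carrier) {xs ys} → xs ↭ ys → sum (map F xs) ≈ sum (map F ys)
    sum-↭ F Permutation.refl         = ≈-refl
    sum-↭ F (Permutation.prep x p)   = ∙-congˡ (sum-↭ F p)
    sum-↭ F (Permutation.swap x y p) =
      ≈-trans (≈-sym (assoc _ _ _)) (≈-trans (∙-cong (comm _ _) (sum-↭ F p)) (assoc _ _ _))
    sum-↭ F (Permutation.trans p q)  = ≈-trans (sum-↭ F p) (sum-↭ F q)

  module _ {a} {A : Set a} where

    -- Defined by recursion on the words instead of through `shuf`: letters already placed are
    -- absorbed into F, so the identities below are inductions for all F at once.
    sumSh : (List A → Carrier) → List A → List A → Carrier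
    sumSh F []       ys       = F ys
    sumSh F (x ∷ xs) []       = F (x ∷ xs)
    sumSh F (x ∷ xs) (y ∷ ys) = sumSh (F ∘ (x ∷_)) xs (y ∷ ys) ∙ sumSh (F ∘ (y ∷_)) (x ∷ xs) ys

    sumDec : (List A → List A → Carrier) → List A → Carrier
    sumDec F []       = F [] []
    sumDec F (x ∷ xs) = F [] (x ∷ xs) ∙ sumDec (F ∘ (x ∷_)) xs

    sumSh-shuf : ∀ F xs ys → sum (map F (shuf xs ys)) ≈ sumSh F xs ys
    sumSh-shuf F []       ys       = identityʳ _
    sumSh-shuf F (x ∷ xs) []       = identityʳ _
    sumSh-shuf F (x ∷ xs) (y ∷ ys) = begin
      sum (map F (map (x ∷_) (shuf xs (y ∷ ys)) ++ map (y ∷_) (shuf (x ∷ xs) ys)))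
        ≈⟨ sum-++ F (map (x ∷_) (shuf xs (y ∷ ys))) _ ⟩
      sum (map F (map (x ∷_) (shuf xs (y ∷ ys)))) ∙ sum (map F (map (y ∷_) (shuf (x ∷ xs) ys)))
        ≡⟨ cong₂ (λ l r → sum l ∙ sum r)
             (List.map-∘ (shuf xs (y ∷ ys))) (List.map-∘ (shuf (x ∷ xs) ys)) ⟨
      sum (map (F ∘ (x ∷_)) (shuf xs (y ∷ ys))) ∙ sum (map (F ∘ (y ∷_)) (shuf (x ∷ xs) ys))
        ≈⟨ ∙-cong (sumSh-shuf _ xs (y ∷ ys)) (sumSh-shuf _ (x ∷ xs) ys) ⟩
      sumSh F (x ∷ xs) (y ∷ ys) ∎

    sumSh-cong : ∀ {F G} xs ys → (∀ u → F u ≈ G u) → sumSh F xs ys ≈ sumSh G xs ys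
    sumSh-cong []       ys       e = e ys
    sumSh-cong (x ∷ xs) []       e = e (x ∷ xs)
    sumSh-cong (x ∷ xs) (y ∷ ys) e =
      ∙-cong (sumSh-cong xs (y ∷ ys) (e ∘ (x ∷_))) (sumSh-cong (x ∷ xs) ys (e ∘ (y ∷_)))

    sumDec-cong : ∀ {F G} xs → (∀ u v → F u v ≈ G u v) → sumDec F xs ≈ sumDec G xs
    sumDec-cong []       e = e [] []
    sumDec-cong (x ∷ xs) e = ∙-cong (e [] (x ∷ xs)) (sumDec-cong xs (e ∘ (x ∷_)))

    sumSh-∙ : ∀ {F G} xs ys → sumSh (λ u → F u ∙ G u) xs ys ≈ sumSh F xs ys ∙ sumSh G xs ys
    sumSh-∙ []       ys       = ≈-refl
    sumSh-∙ (x ∷ xs) []       = ≈-refl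
    sumSh-∙ (x ∷ xs) (y ∷ ys) =
      ≈-trans (∙-cong (sumSh-∙ xs (y ∷ ys)) (sumSh-∙ (x ∷ xs) ys)) (interchange _ _ _ _)

    sumDec-∙ : ∀ {F G} xs → sumDec (λ u v → F u v ∙ G u v) xs ≈ sumDec F xs ∙ sumDec G xs
    sumDec-∙ []       = ≈-refl
    sumDec-∙ (x ∷ xs) = ≈-trans (∙-congˡ (sumDec-∙ xs)) (interchange _ _ _ _)

    sumSh-[]ʳ : ∀ F xs → sumSh F xs [] ≡ F xs
    sumSh-[]ʳ F []       = refl
    sumSh-[]ʳ F (x ∷ xs) = refl

    -- Both sides split according to which of the three words supplies the first letter. Each of the
    -- three parts is the induction hypothesis for F with that letter prefixed; the remaining steps
    -- regroup the summands.
    sumSh-assoc : ∀ F xs ys zs → sumSh (λ u → sumSh F u zs) xs ys ≈ sumSh (sumSh F xs) ys zs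
    sumSh-assoc F []       ys       zs       = ≈-refl
    sumSh-assoc F (x ∷ xs) []       zs       = ≈-refl
    sumSh-assoc F (x ∷ xs) (y ∷ ys) []       =
      sumSh-cong (x ∷ xs) (y ∷ ys) (λ u → reflexive (sumSh-[]ʳ F u))
    sumSh-assoc F X@(x ∷ xs) Y@(y ∷ ys) Z@(z ∷ zs) = begin
      sumSh (λ u → sumSh F (x ∷ u) Z) xs Y ∙ sumSh (λ u → sumSh F (y ∷ u) Z) X ys
        ≈⟨ ∙-cong (sumSh-∙ xs Y) (sumSh-∙ X ys) ⟩
      (sumSh (λ u → sumSh Fx u Z) xs Y ∙ sumSh (λ u → sumSh Fz (x ∷ u) zs) xs Y)
      ∙ (sumSh (λ u → sumSh Fy u Z) X ys ∙ sumSh (λ u → sumSh Fz (y ∷ u) zs) X ys)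
        ≈⟨ interchange _ _ _ _ ⟩
      (sumSh (λ u → sumSh Fx u Z) xs Y ∙ sumSh (λ u → sumSh Fy u Z) X ys)
      ∙ sumSh (λ u → sumSh Fz u zs) X Y
        ≈⟨ ∙-cong (∙-cong (sumSh-assoc Fx xs Y Z) (sumSh-assoc Fy X ys Z)) (sumSh-assoc Fz X Y zs) ⟩
      (sumSh (sumSh Fx xs) Y Z ∙ sumSh (sumSh Fy X) ys Z) ∙ sumSh (sumSh Fz X) Y zs
        ≈⟨ assoc _ _ _ ⟩
      sumSh (sumSh Fx xs) Y Z ∙ (sumSh (sumSh Fy X) ys Z ∙ sumSh (sumSh Fz X) Y zs)
        ≈⟨ interchange _ _ _ _ ⟩
      (sumSh (λ u → sumSh Fx xs (y ∷ u)) ys Z ∙ sumSh (sumSh Fy X) ys Z)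
      ∙ (sumSh (λ u → sumSh Fx xs (z ∷ u)) Y zs ∙ sumSh (sumSh Fz X) Y zs)
        ≈⟨ ∙-cong (sumSh-∙ ys Z) (sumSh-∙ Y zs) ⟨
      sumSh (sumSh F X) Y Z ∎
      where
      Fx = F ∘ (x ∷_)
      Fy = F ∘ (y ∷_)
      Fz = F ∘ (z ∷_)

    -- Both sides run over the ways to write the word as three consecutive factors. Separating the
    -- ones with empty first factor leaves the claim for the tail.
    sumDec-coassoc : ∀ (F : List A → List A → List A → Carrier) xs →
                     sumDec (λ u w → sumDec (λ u' v → F u' v w) u) xs ≈
                     sumDec (λ u w → sumDec (F u) w) xs
    sumDec-coassoc F []       = ≈-refl
    sumDec-coassoc F (x ∷ xs) = ≈-trans
      (∙-congˡ (≈-trans (sumDec-∙ xs) (∙-congˡ (sumDec-coassoc (F ∘ (x ∷_)) xs))))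
      (≈-sym (assoc _ _ _))

    -- Cutting a shuffle of xs and ys amounts to cutting xs and ys and then
    -- shuffling the initial parts and the final parts separately.
    sumDec-sumSh : ∀ F xs ys → sumSh (sumDec F) xs ys ≈
      sumDec (λ x₁ x₂ → sumDec (λ y₁ y₂ → sumSh (λ u → sumSh (F u) x₂ y₂) x₁ y₁) ys) xs
    sumDec-sumSh F []       ys = ≈-refl
    sumDec-sumSh F (x ∷ xs) [] = sumDec-cong (x ∷ xs) λ u v → ≈-sym
      (≈-trans (reflexive (sumSh-[]ʳ (λ u → sumSh (F u) v []) u)) (reflexive (sumSh-[]ʳ (F u) v)))
    sumDec-sumSh F (x ∷ xs) (y ∷ ys) = begin
      sumSh (λ u → F [] (x ∷ u) ∙ sumDec Fx u) xs (y ∷ ys)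
      ∙ sumSh (λ u → F [] (y ∷ u) ∙ sumDec Fy u) (x ∷ xs) ys
        ≈⟨ ∙-cong (sumSh-∙ xs (y ∷ ys)) (sumSh-∙ (x ∷ xs) ys) ⟩
      (sumSh (λ u → F [] (x ∷ u)) xs (y ∷ ys) ∙ sumSh (sumDec Fx) xs (y ∷ ys))
      ∙ (sumSh (λ u → F [] (y ∷ u)) (x ∷ xs) ys ∙ sumSh (sumDec Fy) (x ∷ xs) ys)
        ≈⟨ interchange _ _ _ _ ⟩
      top ∙ (sumSh (sumDec Fx) xs (y ∷ ys) ∙ sumSh (sumDec Fy) (x ∷ xs) ys)
        ≈⟨ ∙-congˡ (∙-cong (sumDec-sumSh Fx xs (y ∷ ys)) (sumDec-sumSh Fy (x ∷ xs) ys)) ⟩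
      top ∙ (sumDec (λ x₁ x₂ → sumDec (H Fx x₁ x₂) (y ∷ ys)) xs ∙ (e ∙ d))
        ≈⟨ ∙-congˡ (≈-trans (≈-sym (assoc _ _ _)) (≈-trans (∙-congʳ (comm _ _)) (assoc _ _ _))) ⟩
      top ∙ (e ∙ (sumDec (λ x₁ x₂ → sumDec (H Fx x₁ x₂) (y ∷ ys)) xs ∙ d))
        ≈⟨ assoc _ _ _ ⟨
      (top ∙ e) ∙ (sumDec (λ x₁ x₂ → sumDec (H Fx x₁ x₂) (y ∷ ys)) xs ∙ d)
        ≈⟨ ∙-congˡ (sumDec-∙ xs) ⟨
      (top ∙ e) ∙ sumDec (λ x₁ x₂ → sumDec (H Fx x₁ x₂) (y ∷ ys) ∙ sumDec (H Fy (x ∷ x₁) x₂) ys) xs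
        ≈⟨ ∙-congˡ (sumDec-cong xs λ x₁ x₂ → ≈-trans (assoc _ _ _)
             (∙-cong (reflexive (sumSh-[]ʳ _ x₁)) (≈-sym (sumDec-∙ ys)))) ⟩
      (top ∙ e) ∙ sumDec (λ x₁ x₂ → sumDec (H F (x ∷ x₁) x₂) (y ∷ ys)) xs ∎
      where
      Fx = F ∘ (x ∷_)
      Fy = F ∘ (y ∷_)
      H : (List A → List A → Carrier) → List A → List A → List A → List A → Carrier
      H F x₁ x₂ y₁ y₂ = sumSh (λ u → sumSh (F u) x₂ y₂) x₁ y₁
      -- The cuts are sorted by their initial part: empty for `top`; beginning with y and free of
      -- letters from `x ∷ xs` for `e`; beginning with y and containing x for `d`. The remaining
      -- summand has initial parts beginning with x.
      top = sumSh (F []) (x ∷ xs) (y ∷ ys)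
      e   = sumDec (λ y₁ y₂ → sumSh (Fy y₁) (x ∷ xs) y₂) ys
      d   = sumDec (λ x₁ x₂ → sumDec (H Fy (x ∷ x₁) x₂) ys) xs

    sumDec-ε : ∀ {F} xs → (∀ u v → F u v ≈ ε) → sumDec F xs ≈ ε
    sumDec-ε []       e = e [] []
    sumDec-ε (x ∷ xs) e = ≈-trans (∙-cong (e [] (x ∷ xs)) (sumDec-ε xs (e ∘ (x ∷_)))) (identityˡ ε)

    sumDec-counitˡ : ∀ {F} xs → (∀ x u v → F (x ∷ u) v ≈ ε) → sumDec F xs ≈ F [] xs
    sumDec-counitˡ []       _ = ≈-refl
    sumDec-counitˡ (x ∷ xs) e = ≈-trans (∙-congˡ (sumDec-ε xs (e x))) (identityʳ _)

    sumDec-counitʳ : ∀ {F} xs → (∀ u y v → F u (y ∷ v) ≈ ε) → sumDec F xs ≈ F xs []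
    sumDec-counitʳ []       _ = ≈-refl
    sumDec-counitʳ (x ∷ xs) e =
      ≈-trans (∙-cong (e [] x xs) (sumDec-counitʳ xs (e ∘ (x ∷_)))) (identityˡ _)

    -- The coproduct indexes its cuts by `Fin (suc n)`, and index i is the cut whose initial part
    -- has length i.
    sum-cuts : ∀ {n} (t : Fin (suc n) → Carrier) F xs → length xs ≡ n →
               (∀ i u v → u ++ v ≡ xs → length u ≡ toℕ i → t i ≈ F u v) →
               sum (tabulate t) ≈ sumDec F xs
    sum-cuts t F []       refl e = ≈-trans (identityʳ _) (e zero [] [] refl refl)
    sum-cuts t F (x ∷ xs) refl e = ∙-cong (e zero [] (x ∷ xs) refl refl)
      (sum-cuts (t ∘ suc) (F ∘ (x ∷_)) xs refl
        λ i u v p q → e (suc i) (x ∷ u) v (cong (x ∷_) p) (cong suc q))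

  sumSh-map : ∀ {a b} {A : Set a} {B : Set b} (f : A → B) F xs ys →
              sumSh F (map f xs) (map f ys) ≡ sumSh (F ∘ map f) xs ys
  sumSh-map f F []       ys       = refl
  sumSh-map f F (x ∷ xs) []       = refl
  sumSh-map f F (x ∷ xs) (y ∷ ys) = cong₂ _∙_ (sumSh-map f _ xs (y ∷ ys)) (sumSh-map f _ (x ∷ xs) ys)

-- Labelled words

_≺_ : ∀ {a} {A : Set a} {N} → List (A × Fin N) → List (A × Fin N) → Set a
u ≺ v = ∀ {x y} → x ∈ u → y ∈ v → proj₂ x Fin.< proj₂ y

Distinct : ∀ {a} {A : Set a} {N} → List (A × Fin N) → Set a
Distinct = AllPairs (λ x y → proj₂ x ≢ proj₂ y)

++-cancel : ∀ {a} {A : Set a} (u u' : List A) {v v'} → length u ≡ length u' →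
            u ++ v ≡ u' ++ v' → u ≡ u' × v ≡ v'
++-cancel []      []        _ e = refl , e
++-cancel (x ∷ u) (x' ∷ u') l e with ++-cancel u u' (ℕ.suc-injective l) (List.∷-injectiveʳ e)
... | p , q = cong₂ _∷_ (List.∷-injectiveˡ e) p , q

tabulate-size : ∀ {a} {A : Set a} {n m} {f : Fin n → A} {g : Fin m → A} →
                tabulate f ≡ tabulate g → n ≡ m
tabulate-size {f = f} {g} e =
  trans (sym (List.length-tabulate f)) (trans (cong length e) (List.length-tabulate g))

tabulate-++ : ∀ {a} {A : Set a} p {q} (t : Fin (p + q) → A) →
              tabulate t ≡ tabulate (t ∘ (_↑ˡ q)) ++ tabulate (t ∘ (p ↑ʳ_))
tabulate-++ zero    t = refl
tabulate-++ (suc p) t = cong (t zero ∷_) (tabulate-++ p (t ∘ suc))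

module _ {c ℓ m ℓm} (K : CommutativeRing c ℓ) (V : Module K m ℓm) where

  open CommutativeRing K using () renaming (_≈_ to _≈ₖ_; _*_ to _*ₖ_; 0# to 0ₖ; 1# to 1ₖ)
  private module K = CommutativeRing K
  open Module V using (Carrierᴹ; _≈ᴹ_; _+ᴹ_; _*ₗ_; ≈ᴹ-refl; ≈ᴹ-reflexive)
  open Construction K V hiding (refl; sym; trans)

  -- Linear extension of maps on generators

  ≈-reflexive : ∀ {g r} {G : Set g} {R : Term G → Term G → Set r} {x y} → x ≡ y → Cl R x y
  ≈-reflexive refl = Cl.refl

  termMonoid : ∀ {g r} {G : Set g} (R : Term G → Term G → Set r) → CommutativeMonoid _ _
  termMonoid R = record
    { Carrier = Term _ ; _≈_ = Cl R ; _∙_ = _⊕_ ; ε = 𝟘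
    ; isCommutativeMonoid = record
      { isMonoid = record
        { isSemigroup = record
          { isMagma = record
            { isEquivalence = record { refl = Cl.refl ; sym = Cl.sym ; trans = Cl.trans }
            ; ∙-cong = ⊕-cong }
          ; assoc = λ _ _ _ → ⊕-assoc }
        ; identity = (λ _ → ⊕-identity) , (λ _ → Cl.trans ⊕-comm ⊕-identity) }
      ; comm = λ _ _ → ⊕-comm } }

  module TermSums {g r} {G : Set g} (R : Term G → Term G → Set r) where
    open Sums (termMonoid R) public

  module TermReasoning {g r} {G : Set g} (R : Term G → Term G → Set r) =
    ≈-Reasoning (CommutativeMonoid.setoid (termMonoid R))

  module _ {g r} {G : Set g} {R : Term G → Term G → Set r} where
    open CommutativeMonoid (termMonoid R) using (identityʳ; commutativeSemigroup)
    open CommutativeSemigroupProperties commutativeSemigroup using (interchange)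
    open TermReasoning R

    -- `Cl` has no rule that makes `a ⊙ 𝟘` or `0ₖ ⊙ x` vanish. Distributivity shows that both equal
    -- their own doubles, and cancelling one copy gives 𝟘.
    idempotent⇒𝟘 : ∀ {x} → Cl R x (x ⊕ x) → Cl R x 𝟘
    idempotent⇒𝟘 {x} e = begin
      x                            ≈⟨ identityʳ x ⟨
      x ⊕ 𝟘                        ≈⟨ ⊕-cong Cl.refl ⊕-inverse ⟨
      x ⊕ (x ⊕ (K.- 1ₖ) ⊙ x)       ≈⟨ ⊕-assoc ⟨
      (x ⊕ x) ⊕ (K.- 1ₖ) ⊙ x       ≈⟨ ⊕-cong e Cl.refl ⟨
      x ⊕ (K.- 1ₖ) ⊙ x             ≈⟨ ⊕-inverse ⟩
      𝟘 ∎

    ⊙-zeroʳ : ∀ {a} → Cl R (a ⊙ 𝟘) 𝟘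
    ⊙-zeroʳ = idempotent⇒𝟘 (Cl.trans (⊙-cong K.refl (Cl.sym ⊕-identity)) ⊙-distribˡ)

    ⊙-zeroˡ : ∀ {x} → Cl R (0ₖ ⊙ x) 𝟘
    ⊙-zeroˡ = idempotent⇒𝟘 (Cl.trans (⊙-cong (K.sym (K.+-identityˡ 0ₖ)) Cl.refl) ⊙-distribʳ)

    ⊙-swap : ∀ {a b x} → Cl R (a ⊙ b ⊙ x) (b ⊙ a ⊙ x)
    ⊙-swap = Cl.trans (Cl.sym ⊙-assoc) (Cl.trans (⊙-cong (K.*-comm _ _) Cl.refl) ⊙-assoc)

    ext-cong : ∀ {h} {H : Set h} {φ ψ : H → Term G} → (∀ a → Cl R (φ a) (ψ a)) →
               ∀ x → Cl R (ext φ x) (ext ψ x)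
    ext-cong e (gen a) = e a
    ext-cong e 𝟘       = Cl.refl
    ext-cong e (x ⊕ y) = ⊕-cong (ext-cong e x) (ext-cong e y)
    ext-cong e (a ⊙ x) = ⊙-cong K.refl (ext-cong e x)

    ext-𝟘 : ∀ {h} {H : Set h} x → Cl R (ext (λ (_ : H) → 𝟘) x) 𝟘
    ext-𝟘 (gen a) = Cl.refl
    ext-𝟘 𝟘       = Cl.refl
    ext-𝟘 (x ⊕ y) = Cl.trans (⊕-cong (ext-𝟘 x) (ext-𝟘 y)) ⊕-identity
    ext-𝟘 (a ⊙ x) = Cl.trans (⊙-cong K.refl (ext-𝟘 x)) ⊙-zeroʳ

    ext-⊕ : ∀ {h} {H : Set h} {φ ψ : H → Term G} x → Cl R (ext (λ a → φ a ⊕ ψ a) x) (ext φ x ⊕ ext ψ x)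
    ext-⊕ (gen a) = Cl.refl
    ext-⊕ 𝟘       = Cl.sym ⊕-identity
    ext-⊕ (x ⊕ y) = Cl.trans (⊕-cong (ext-⊕ x) (ext-⊕ y)) (interchange _ _ _ _)
    ext-⊕ (a ⊙ x) = Cl.trans (⊙-cong K.refl (ext-⊕ x)) ⊙-distribˡ

    ext-⊙ : ∀ {h} {H : Set h} {a} {φ : H → Term G} x → Cl R (ext (λ b → a ⊙ φ b) x) (a ⊙ ext φ x)
    ext-⊙ (gen b) = Cl.refl
    ext-⊙ 𝟘       = Cl.sym ⊙-zeroʳ
    ext-⊙ (x ⊕ y) = Cl.trans (⊕-cong (ext-⊙ x) (ext-⊙ y)) (Cl.sym ⊙-distribˡ)
    ext-⊙ (b ⊙ x) = Cl.trans (⊙-cong K.refl (ext-⊙ x)) ⊙-swap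

    ext-swap : ∀ {h i} {H : Set h} {I : Set i} (φ : H → I → Term G) x y →
               Cl R (ext (λ a → ext (φ a) y) x) (ext (λ b → ext (λ a → φ a b) x) y)
    ext-swap φ (gen a)  y = Cl.refl
    ext-swap φ 𝟘        y = Cl.sym (ext-𝟘 y)
    ext-swap φ (x ⊕ x') y = Cl.trans (⊕-cong (ext-swap φ x y) (ext-swap φ x' y)) (Cl.sym (ext-⊕ y))
    ext-swap φ (a ⊙ x)  y = Cl.trans (⊙-cong K.refl (ext-swap φ x y)) (Cl.sym (ext-⊙ y))

    -- `ext` commutes with `⊕` and `⊙` by definition, so the module laws carry over to themselves
    -- and only the defining relations need a check.
    ext-resp : ∀ {h s} {H : Set h} {S : Term H → Term H → Set s} {φ : H → Term G} →
               (∀ {x y} → S x y → Cl R (ext φ x) (ext φ y)) →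
               ∀ {x y} → Cl S x y → Cl R (ext φ x) (ext φ y)
    ext-resp e (base r)     = e r
    ext-resp e Cl.refl      = Cl.refl
    ext-resp e (Cl.sym p)   = Cl.sym (ext-resp e p)
    ext-resp e (Cl.trans p q) = Cl.trans (ext-resp e p) (ext-resp e q)
    ext-resp e (⊕-cong p q) = ⊕-cong (ext-resp e p) (ext-resp e q)
    ext-resp e (⊙-cong a p) = ⊙-cong a (ext-resp e p)
    ext-resp e ⊕-assoc      = ⊕-assoc
    ext-resp e ⊕-comm       = ⊕-comm
    ext-resp e ⊕-identity   = ⊕-identity
    ext-resp e ⊕-inverse    = ⊕-inverse
    ext-resp e ⊙-assoc      = ⊙-assoc
    ext-resp e ⊙-identity   = ⊙-identity
    ext-resp e ⊙-distribˡ   = ⊙-distribˡ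
    ext-resp e ⊙-distribʳ   = ⊙-distribʳ

    sumT-linear : ∀ {i} {I : Set i} {s t u : I → Term G} {a} (xs : List I) →
                  (∀ x → Cl R (s x) (a ⊙ t x ⊕ u x)) →
                  Cl R (sumT (map s xs)) (a ⊙ sumT (map t xs) ⊕ sumT (map u xs))
    sumT-linear []       e = Cl.sym (Cl.trans (⊕-cong ⊙-zeroʳ Cl.refl) ⊕-identity)
    sumT-linear (x ∷ xs) e = Cl.trans (⊕-cong (e x) (sumT-linear xs e))
      (Cl.trans (interchange _ _ _ _) (⊕-cong (Cl.sym ⊙-distribˡ) Cl.refl))

  module _ {g h} {G : Set g} {H : Set h} where

    ext-∘ : ∀ {i} {I : Set i} (φ : G → Term H) (ψ : I → Term G) x → ext φ (ext ψ x) ≡ ext (ext φ ∘ ψ) x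
    ext-∘ φ ψ (gen a) = refl
    ext-∘ φ ψ 𝟘       = refl
    ext-∘ φ ψ (x ⊕ y) = cong₂ _⊕_ (ext-∘ φ ψ x) (ext-∘ φ ψ y)
    ext-∘ φ ψ (a ⊙ x) = cong (a ⊙_) (ext-∘ φ ψ x)

    ext-sumT : ∀ {i} {I : Set i} (φ : G → Term H) (t : I → Term G) xs →
               ext φ (sumT (map t xs)) ≡ sumT (map (ext φ ∘ t) xs)
    ext-sumT φ t []       = refl
    ext-sumT φ t (x ∷ xs) = cong (ext φ (t x) ⊕_) (ext-sumT φ t xs)

    ext-≗ : ∀ {φ ψ : G → Term H} → φ ≗ ψ → ext φ ≗ ext ψ
    ext-≗ e (gen a) = e a
    ext-≗ e 𝟘       = refl
    ext-≗ e (x ⊕ y) = cong₂ _⊕_ (ext-≗ e x) (ext-≗ e y)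
    ext-≗ e (a ⊙ x) = cong (a ⊙_) (ext-≗ e x)

  ext-⊗ : ∀ {g h i} {G : Set g} {H : Set h} {I : Set i} (φ : G × H → Term I) x y →
          ext φ (x ⊗ₜ y) ≡ ext (λ a → ext (λ b → φ (a , b)) y) x
  ext-⊗ φ x y = trans (ext-∘ φ _ x) (ext-≗ (λ a → ext-∘ φ (λ b → gen (a , b)) y) x)

  ext-gen : ∀ {g} {G : Set g} (x : Term G) → ext gen x ≡ x
  ext-gen (gen a) = refl
  ext-gen 𝟘       = refl
  ext-gen (x ⊕ y) = cong₂ _⊕_ (ext-gen x) (ext-gen y)
  ext-gen (a ⊙ x) = cong (a ⊙_) (ext-gen x)

  module _ {g h r s} {G : Set g} {H : Set h}
           {R : Term G → Term G → Set r} {S : Term H → Term H → Set s} where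

    tensor-congˡ : ∀ {x y} b → Cl R x y → Cl (R ⊗ᴿ S) (mapT (_, b) x) (mapT (_, b) y)
    tensor-congˡ b = ext-resp (λ p → base (left p b))

    tensor-congʳ : ∀ {x y} a → Cl S x y → Cl (R ⊗ᴿ S) (mapT (a ,_) x) (mapT (a ,_) y)
    tensor-congʳ a = ext-resp (λ p → base (right a p))

    gen-cong₂ : ∀ {a a' b b'} → Cl R (gen a) (gen a') → Cl S (gen b) (gen b') →
                Cl (R ⊗ᴿ S) (gen (a , b)) (gen (a' , b'))
    gen-cong₂ p q = Cl.trans (tensor-congˡ _ p) (tensor-congʳ _ q)

  -- Words spelling generators

  Letter : ℕ → Set m
  Letter N = Carrierᴹ × Fin N

  -- The word w spells the generator (v₁⊗⋯⊗vₙ) # σ: its letters are the vᵢ,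
  -- with distinct labels in the relative order of σ⁻¹(1)⋯σ⁻¹(n).
  record Rep {N} (w : List (Letter N)) (g : GenF) : Set m where
    constructor rep
    field
      label  : Fin (deg g) → Fin N
      inj    : Inj label
      sorts  : Sorts label (proj₂ (proj₂ g))
      spells : w ≡ tabulate (λ i → proj₁ (proj₂ g) i , label i)

  Rep⇒Distinct : ∀ {N} {w : List (Letter N)} {g} → Rep w g → Distinct w
  Rep⇒Distinct (rep f f-inj _ refl) = AllPairs.tabulate⁺ (λ i≢j e → i≢j (f-inj e))

  -- A generator determined by the word alone; with it, sums over words become elements of 𝓕(V).
  canon : ∀ {N} → List (Letter N) → GenF
  canon w = length w , proj₁ ∘ List.lookup w , encode (inv (std (proj₂ ∘ List.lookup w)))

  Rep-canon : ∀ {N} {w : List (Letter N)} → Distinct w → Rep w (canon w)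
  Rep-canon {w = w} d =
    rep (proj₂ ∘ List.lookup w) l-inj (std-Sorts l-inj) (sym (List.tabulate-lookup w))
    where l-inj = lookup-Inj proj₂ d

  -- The word fixes the vectors and the labels, and the labels fix the permutation by
  -- `Sorts-unique`. The vectors agree only pointwise, which `respects-≈` turns into `≈F`.
  Rep-unique : ∀ {N} {w : List (Letter N)} {g h} → Rep w g → Rep w h → gen g ≈F gen h
  Rep-unique {g = n , v , σ} {n' , v' , σ'} (rep f f-inj f-sorts refl) (rep f' f'-inj f'-sorts e)
    with tabulate-size e
  ... | refl = Cl.trans (base (respects-≈ v v' σ (λ i → ≈ᴹ-reflexive (cong proj₁ (e' i)))))
                 (≈-reflexive (cong (λ σ → gen (n , v' , σ))
                   (Sorts-unique σ σ' f-inj f-sorts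
                     (λ lt → f'-sorts (subst₂ Fin._<_ (cong proj₂ (e' _)) (cong proj₂ (e' _)) lt)))))
    where e' = tabulate-injective e

  gen-canon : ∀ {N} {w : List (Letter N)} {g} → Rep w g → gen g ≈F gen (canon w)
  gen-canon r = Rep-unique r (Rep-canon (Rep⇒Distinct r))

  -- An increasing ι keeps the relative order of the labels while choosing where in `Fin N` they
  -- lie; this is how one word is pushed above another.
  spell : ∀ {N} (g : GenF) → (Fin (deg g) → Fin N) → List (Letter N)
  spell (n , v , σ) ι = tabulate (λ i → v i , ι (decode⁻¹ σ i))

  Rep-spell : ∀ {N} g {ι : Fin (deg g) → Fin N} → Mono ι → Rep (spell g ι) g
  Rep-spell (n , v , σ) {ι} ι-mono =
    rep (ι ∘ decode⁻¹ σ) (λ e → decode⁻¹-Inj σ (ι-inj e)) ι-reflects refl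
    where
    ι-inj : Inj ι
    ι-inj {x} {y} e with Fin.<-cmp x y
    ... | tri< lt _ _ = ⊥-elim (ℕ.<-irrefl (cong toℕ e) (ι-mono lt))
    ... | tri≈ _ eq _ = eq
    ... | tri> _ _ gt = ⊥-elim (ℕ.<-irrefl (cong toℕ (sym e)) (ι-mono gt))
    ι-reflects : ∀ {x y} → ι x Fin.< ι y → x Fin.< y
    ι-reflects {x} {y} lt with Fin.<-cmp x y
    ... | tri< x<y _ _ = x<y
    ... | tri≈ _ eq _  = ⊥-elim (ℕ.<-irrefl (cong (toℕ ∘ ι) eq) lt)
    ... | tri> _ _ gt  = ⊥-elim (ℕ.<-asym lt (ι-mono gt))

  spell-≺ : ∀ {N} g h {ι : Fin (deg g) → Fin N} {κ : Fin (deg h) → Fin N} →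
            (∀ i j → ι i Fin.< κ j) → spell g ι ≺ spell h κ
  spell-≺ g h ι<κ p q with ∈-tabulate⁻ p | ∈-tabulate⁻ q
  ... | _ , refl | _ , refl = ι<κ _ _

  Rep-𝟙 : ∀ {N} → Rep {N} [] 𝟙
  Rep-𝟙 = rep (λ ()) (λ { {()} }) (λ { {()} }) refl

  -- The product on words

  module _ {h r} {H : Set h} {R : Term H → Term H → Set r} where
    open TermSums R

    -- Each shuffle π contributes the generator spelled by the letters of `u ++ u'` rearranged by π;
    -- `words-of-shuffles` then turns the sum over permutations into one over words. Working under
    -- an arbitrary φ lets nested operations be expanded before they are known to respect `≈F`. The
    -- hypothesis passes on that w permutes `u ++ u'`, so that separation from a third word can
    -- still be checked.
    ext-mulG : ∀ {N} {u u' : List (Letter N)} {a b} → Rep u a → Rep u' b → u ≺ u' →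
               {φ : GenF → Term H} {Φ : List (Letter N) → Term H} →
               (∀ w g → w ↭ u ++ u' → Rep w g → Cl R (φ g) (Φ w)) →
               Cl R (ext φ (mulG a b)) (sumSh Φ u u')
    ext-mulG {N} {u} {u'} {a@(n , v , σ)} {b@(n' , v' , σ')}
      (rep f f-inj f-sorts refl) (rep f' f'-inj f'-sorts refl) u≺u' {φ} {Φ} e =
      begin
        ext φ (mulG a b)
          ≡⟨ ext-sumT φ (λ π → gen (term π)) (shuffles n n') ⟩
        sumT (map (φ ∘ term) (shuffles n n'))
          ≈⟨ sum-cong (shuffles n n') (λ {π} π∈ → e _ _ (permutes π∈) (Rep-term π)) ⟩
        sumT (map (Φ ∘ map letter ∘ word) (shuffles n n'))
          ≡⟨ cong sumT (List.map-∘ (shuffles n n')) ⟩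
        sumT (map (Φ ∘ map letter) (map word (shuffles n n')))
          ≈⟨ sum-↭ (Φ ∘ map letter) (words-of-shuffles n n') ⟩
        sumT (map (Φ ∘ map letter) (shuf (lefts n n') (rights n n')))
          ≈⟨ sumSh-shuf (Φ ∘ map letter) (lefts n n') (rights n n') ⟩
        sumSh (Φ ∘ map letter) (lefts n n') (rights n n')
          ≡⟨ sumSh-map letter Φ (lefts n n') (rights n n') ⟨
        sumSh Φ (map letter (lefts n n')) (map letter (rights n n'))
          ≡⟨ cong₂ (sumSh Φ) letters-l letters-r ⟩
        sumSh Φ u u' ∎
      where
      open TermReasoning R

      F : Fin (n + n') → Fin N
      F i = [ f , f' ]′ (splitAt n i)

      letter : Fin (n + n') → Letter N
      letter i = (v ++ᵛ v') i , F i

      letters-l : map letter (lefts n n') ≡ u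
      letters-l = trans (List.map-tabulate (_↑ˡ n') letter) (List.tabulate-cong λ i →
        cong (λ s → [ v , v' ]′ s , [ f , f' ]′ s) (Fin.splitAt-↑ˡ n i n'))

      letters-r : map letter (rights n n') ≡ u'
      letters-r = trans (List.map-tabulate (n ↑ʳ_) letter) (List.tabulate-cong λ i →
        cong (λ s → [ v , v' ]′ s , [ f , f' ]′ s) (Fin.splitAt-↑ʳ n n' i))

      F-l : ∀ i → F (i ↑ˡ n') ≡ f i
      F-l i = cong [ f , f' ]′ (Fin.splitAt-↑ˡ n i n')

      F-r : ∀ j → F (n ↑ʳ j) ≡ f' j
      F-r j = cong [ f , f' ]′ (Fin.splitAt-↑ʳ n n' j)

      f<f' : ∀ i j → f i Fin.< f' j
      f<f' i j = u≺u' (∈-tabulate⁺ i) (∈-tabulate⁺ j)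

      F-inj : Inj F
      F-inj {x} {y} e with splitView n n' x | splitView n n' y
      ... | fromˡ i | fromˡ j = cong (_↑ˡ n') (f-inj (trans (sym (F-l i)) (trans e (F-l j))))
      ... | fromˡ i | fromʳ j = ⊥-elim
        (ℕ.<-irrefl (cong toℕ (trans (sym (F-l i)) (trans e (F-r j)))) (f<f' i j))
      ... | fromʳ i | fromˡ j = ⊥-elim
        (ℕ.<-irrefl (cong toℕ (trans (sym (F-l j)) (trans (sym e) (F-r i)))) (f<f' j i))
      ... | fromʳ i | fromʳ j = cong (n ↑ʳ_) (f'-inj (trans (sym (F-r i)) (trans e (F-r j))))

      -- Within a block the comparison is that of σ, or of σ' shifted by n; across the blocks both
      -- orders put the first one below.
      F-sorts : Sorts F (σ ×ₚ σ')
      F-sorts {x} {y} lt with splitView n n' x | splitView n n' y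
      ... | fromˡ i | fromˡ j = subst₂ ℕ._<_ (pos i) (pos j)
        (f-sorts (subst₂ Fin._<_ (F-l i) (F-l j) lt))
        where
        pos : ∀ i → toℕ (decode⁻¹ σ i) ≡ toℕ (decode⁻¹ (σ ×ₚ σ') (i ↑ˡ n'))
        pos i = sym (trans (cong toℕ (decode⁻¹-×ₚ-↑ˡ σ σ' i)) (Fin.toℕ-↑ˡ _ n'))
      ... | fromˡ i | fromʳ j = subst₂ ℕ._<_
        (sym (trans (cong toℕ (decode⁻¹-×ₚ-↑ˡ σ σ' i)) (Fin.toℕ-↑ˡ _ n')))
        (sym (trans (cong toℕ (decode⁻¹-×ₚ-↑ʳ σ σ' j)) (Fin.toℕ-↑ʳ n _)))
        (ℕ.<-≤-trans (Fin.toℕ<n (decode⁻¹ σ i)) (ℕ.m≤m+n n _))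
      ... | fromʳ i | fromˡ j = ⊥-elim (ℕ.<-asym (f<f' j i) (subst₂ Fin._<_ (F-r i) (F-l j) lt))
      ... | fromʳ i | fromʳ j = subst₂ ℕ._<_ (pos i) (pos j)
        (ℕ.+-monoʳ-< n (f'-sorts (subst₂ Fin._<_ (F-r i) (F-r j) lt)))
        where
        pos : ∀ i → n + toℕ (decode⁻¹ σ' i) ≡ toℕ (decode⁻¹ (σ ×ₚ σ') (n ↑ʳ i))
        pos i = sym (trans (cong toℕ (decode⁻¹-×ₚ-↑ʳ σ σ' i)) (Fin.toℕ-↑ʳ n _))

      term : Perm (n + n') → GenF
      term π = n + n' , (λ i → (v ++ᵛ v') (decode⁻¹ π i)) , (π ∘ₚ (σ ×ₚ σ'))

      Rep-term : ∀ π → Rep (map letter (word π)) (term π)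
      Rep-term π = rep (F ∘ decode⁻¹ π) (decode⁻¹-Inj π ∘ F-inj)
        (λ lt → subst₂ Fin._<_
          (sym (decode⁻¹-∘ₚ π (σ ×ₚ σ') _)) (sym (decode⁻¹-∘ₚ π (σ ×ₚ σ') _)) (F-sorts lt))
        (List.map-tabulate (decode⁻¹ π) letter)

      permutes : ∀ {π} → π ∈ shuffles n n' → map letter (word π) ↭ u ++ u'
      permutes {π} π∈ = subst (map letter (word π) ↭_)
        (trans (List.map-++ letter (lefts n n') _) (cong₂ _++_ letters-l letters-r))
        (↭.map⁺ letter (shuffle⇒↭ n n' π∈))

  -- The coproduct on words

  restrict : ∀ {n p} → (Fin p → Fin n) → (Fin n → Carrierᴹ) → Perm n → GenF
  restrict {p = p} e v σ = p , v ∘ e , encode (inv (std (decode⁻¹ σ ∘ e)))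

  Cut : ℕ → Set
  Cut n = Σ[ p ∈ ℕ ] Σ[ q ∈ ℕ ] (p + q ≡ n)

  initial : ∀ {n} ((p , _) : Cut n) → Fin p → Fin n
  initial (p , q , eq) j = cast eq (j ↑ˡ q)

  final : ∀ {n} ((_ , q , _) : Cut n) → Fin q → Fin n
  final (p , q , eq) j = cast eq (p ↑ʳ j)

  initial-Inj : ∀ {n} (k : Cut n) → Inj (initial k)
  initial-Inj (p , q , refl) e = Fin.↑ˡ-injective q _ _
    (trans (sym (Fin.cast-is-id refl _)) (trans e (Fin.cast-is-id refl _)))

  final-Inj : ∀ {n} (k : Cut n) → Inj (final k)
  final-Inj (p , q , refl) e = Fin.↑ʳ-injective p _ _
    (trans (sym (Fin.cast-is-id refl _)) (trans e (Fin.cast-is-id refl _)))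

  piece : ∀ {n} → (Fin n → Carrierᴹ) → Perm n → Cut n → GenF × GenF
  piece v σ k = restrict (initial k) v σ , restrict (final k) v σ

  -- The subword keeps its original labels: f and σ⁻¹ order positions alike, so standardizing σ⁻¹ ∘
  -- e also sorts f ∘ e.
  Rep-restrict : ∀ {n p N} {v : Fin n → Carrierᴹ} {σ} {f : Fin n → Fin N} → Inj f → Sorts f σ →
                 {e : Fin p → Fin n} → Inj e → Rep (tabulate (λ i → v (e i) , f (e i))) (restrict e v σ)
  Rep-restrict {σ = σ} {f} f-inj f-sorts {e} e-inj =
    rep (f ∘ e) (e-inj ∘ f-inj)
      (λ lt → std-Sorts {w = decode⁻¹ σ ∘ e} (e-inj ∘ decode⁻¹-Inj σ) (f-sorts lt)) refl

  tabulate-cut : ∀ {a} {A : Set a} {n} (k : Cut n) (t : Fin n → A) →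
                 tabulate t ≡ tabulate (t ∘ initial k) ++ tabulate (t ∘ final k)
  tabulate-cut (p , q , refl) t =
    trans (List.tabulate-cong (λ i → cong t (sym (Fin.cast-is-id refl i))))
      (tabulate-++ p (t ∘ cast refl))

  coprodG-pieces : ∀ {n} (v : Fin n → Carrierᴹ) σ →
                   coprodG (n , v , σ) ≡ sumT (map (λ k → gen (piece v σ k)) (splits n))
  coprodG-pieces {n} v σ = cong {B = Term (GenF × GenF)} (λ f → sumT (map f (splits n))) refl

  cutAt : ∀ {n} → Fin (suc n) → Cut n
  cutAt {n} i = toℕ i , n ∸ toℕ i , ℕ.m+[n∸m]≡n (Fin.toℕ≤pred[n] i)

  map-splits : ∀ {a} {A : Set a} {n} (t : Cut n → A) → map t (splits n) ≡ tabulate (t ∘ cutAt)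
  map-splits {n = n} t =
    trans (cong (map t) (List.map-tabulate (λ i → i) (cutAt {n}))) (List.map-tabulate (cutAt {n}) t)

  Rep-piece : ∀ {n N} {v : Fin n → Carrierᴹ} {σ} {w : List (Letter N)} → Rep w (n , v , σ) →
              ∀ k u u' → u ++ u' ≡ w → length u ≡ proj₁ k →
              Rep u (proj₁ (piece v σ k)) × Rep u' (proj₂ (piece v σ k))
  Rep-piece {v = v} {σ} (rep f f-inj f-sorts w≡) k u u' uu'≡w len =
    subst (λ x → Rep x (restrict (initial k) v σ)) (sym (proj₁ u≡))
      (Rep-restrict {v = v} {σ = σ} {f} f-inj f-sorts {initial k} (initial-Inj k)) ,
    subst (λ x → Rep x (restrict (final k) v σ)) (sym (proj₂ u≡))
      (Rep-restrict {v = v} {σ = σ} {f} f-inj f-sorts {final k} (final-Inj k))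
    where
    letter = λ i → v i , f i
    u≡ : u ≡ tabulate (letter ∘ initial k) × u' ≡ tabulate (letter ∘ final k)
    u≡ = ++-cancel u (tabulate (letter ∘ initial k))
      (trans len (sym (List.length-tabulate (letter ∘ initial k))))
      (trans uu'≡w (trans w≡ (tabulate-cut k letter)))

  module _ {h r} {H : Set h} {R : Term H → Term H → Set r} where
    open TermSums R

    -- Counterpart of `ext-mulG`: each cut of the positions is a cut of w whose parts spell the two
    -- pieces. The equation `u ++ u' ≡ w` is passed on so that the parts inherit separation from
    -- other words.
    ext-coprodG : ∀ {N} {w : List (Letter N)} {a} → Rep w a →
                  {φ : GenF × GenF → Term H} {Φ : List (Letter N) → List (Letter N) → Term H} →
                  (∀ u u' g g' → u ++ u' ≡ w → Rep u g → Rep u' g' → Cl R (φ (g , g')) (Φ u u')) →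
                  Cl R (ext φ (coprodG a)) (sumDec Φ w)
    ext-coprodG {w = w} {n , v , σ} r {φ} {Φ} e = begin
      ext φ (coprodG (n , v , σ))
        ≡⟨ cong (ext φ) (coprodG-pieces v σ) ⟩
      ext φ (sumT (map (λ k → gen (piece v σ k)) (splits n)))
        ≡⟨ ext-sumT φ (λ k → gen (piece v σ k)) (splits n) ⟩
      sumT (map (φ ∘ piece v σ) (splits n))
        ≡⟨ cong sumT (map-splits (φ ∘ piece v σ)) ⟩
      sumT (tabulate (φ ∘ piece v σ ∘ cutAt))
        ≈⟨ sum-cuts (φ ∘ piece v σ ∘ cutAt) Φ w
             (trans (cong length (Rep.spells r)) (List.length-tabulate _)) at ⟩
      sumDec Φ w ∎
      where
      open TermReasoning R

      at : ∀ i u u' → u ++ u' ≡ w → length u ≡ toℕ i → Cl R (φ (piece v σ (cutAt i))) (Φ u u')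
      at i u u' uu'≡w len = e u u' (restrict (initial (cutAt i)) v σ) (restrict (final (cutAt i)) v σ)
        uu'≡w (proj₁ reps) (proj₂ reps)
        where reps = Rep-piece r (cutAt i) u u' uu'≡w len

  private
    module F   = TermSums RelF
    module FF  = TermSums RelFF
    module FFF = TermSums RelFFF

  G : ∀ {N} → List (Letter N) → Term GenF
  G w = gen (canon w)

  -- Bialgebra axioms

  record SeparatedWords (a b d : GenF) : Set m where
    field
      {N}            : ℕ
      {u v w}        : List (Letter N)
      rep-a          : Rep u a
      rep-b          : Rep v b
      rep-d          : Rep w d
      u≺v            : u ≺ v
      u≺w            : u ≺ w
      v≺w            : v ≺ w

  -- The labels fill three consecutive blocks of `Fin (deg a + (deg b + deg d))`. Axioms about fewer
  -- generators put 𝟙 in the free places.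
  separated-words : ∀ a b d → SeparatedWords a b d
  separated-words a b d = record
    { rep-a = Rep-spell a ι-mono ; rep-b = Rep-spell b κ-mono ; rep-d = Rep-spell d λ-mono
    ; u≺v = spell-≺ a b ι<κ ; u≺w = spell-≺ a d (λ i k → ι<↑ʳ i (deg b ↑ʳ k))
    ; v≺w = spell-≺ b d κ<λ }
    where
    k = deg b + deg d

    ↑ˡ-mono : ∀ {n} m → Mono (λ (i : Fin n) → i ↑ˡ m)
    ↑ˡ-mono m lt = subst₂ ℕ._<_ (sym (Fin.toℕ-↑ˡ _ m)) (sym (Fin.toℕ-↑ˡ _ m)) lt

    ↑ʳ-mono : ∀ n {m} → Mono (λ (i : Fin m) → n ↑ʳ i)
    ↑ʳ-mono n lt = subst₂ ℕ._<_ (sym (Fin.toℕ-↑ʳ n _)) (sym (Fin.toℕ-↑ʳ n _)) (ℕ.+-monoʳ-< n lt)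

    ↑ˡ<↑ʳ : ∀ {n m} (i : Fin n) (j : Fin m) → i ↑ˡ m Fin.< n ↑ʳ j
    ↑ˡ<↑ʳ {n} {m} i j = subst₂ ℕ._<_ (sym (Fin.toℕ-↑ˡ i m)) (sym (Fin.toℕ-↑ʳ n j))
      (ℕ.<-≤-trans (Fin.toℕ<n i) (ℕ.m≤m+n n (toℕ j)))

    ι-mono : Mono (λ (i : Fin (deg a)) → i ↑ˡ k)
    ι-mono = ↑ˡ-mono k
    κ-mono : Mono (λ (i : Fin (deg b)) → deg a ↑ʳ (i ↑ˡ deg d))
    κ-mono lt = ↑ʳ-mono (deg a) (↑ˡ-mono (deg d) lt)
    λ-mono : Mono (λ (i : Fin (deg d)) → deg a ↑ʳ (deg b ↑ʳ i))
    λ-mono lt = ↑ʳ-mono (deg a) (↑ʳ-mono (deg b) lt)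
    ι<↑ʳ : ∀ (i : Fin (deg a)) (j : Fin k) → i ↑ˡ k Fin.< deg a ↑ʳ j
    ι<↑ʳ = ↑ˡ<↑ʳ
    ι<κ : ∀ (i : Fin (deg a)) (j : Fin (deg b)) → i ↑ˡ k Fin.< deg a ↑ʳ (j ↑ˡ deg d)
    ι<κ i j = ι<↑ʳ i (j ↑ˡ deg d)
    κ<λ : ∀ (i : Fin (deg b)) (j : Fin (deg d)) → deg a ↑ʳ (i ↑ˡ deg d) Fin.< deg a ↑ʳ (deg b ↑ʳ j)
    κ<λ i j = ↑ʳ-mono (deg a) (↑ˡ<↑ʳ i j)

  *-ext : ∀ x y → x * y ≡ ext (λ a → ext (mulG a) y) x
  *-ext x y = ext-⊗ (λ p → mulG (proj₁ p) (proj₂ p)) x y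

  -- A shuffle has the letters of the concatenation, so the words of a product stay separated from a
  -- third word; associativity relies on this.
  ≺-↭ˡ : ∀ {N} {u v w z : List (Letter N)} → z ↭ u ++ v → u ≺ w → v ≺ w → z ≺ w
  ≺-↭ˡ {u = u} p u≺w v≺w x∈ y∈ = [ (λ x∈u → u≺w x∈u y∈) , (λ x∈v → v≺w x∈v y∈) ]′
    (∈-++⁻ u (↭.∈-resp-↭ p x∈))

  ≺-↭ʳ : ∀ {N} {u v w z : List (Letter N)} → z ↭ v ++ w → u ≺ v → u ≺ w → u ≺ z
  ≺-↭ʳ {v = v} p u≺v u≺w x∈ y∈ = [ u≺v x∈ , u≺w x∈ ]′ (∈-++⁻ v (↭.∈-resp-↭ p y∈))

  mulG-assoc : ∀ a b d → ext (λ g → mulG g d) (mulG a b) ≈F ext (mulG a) (mulG b d)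
  mulG-assoc a b d = begin
    ext (λ g → mulG g d) (mulG a b)
      ≈⟨ ext-mulG rep-a rep-b u≺v (λ w' g p r → mulG-sum r rep-d (≺-↭ˡ p u≺w v≺w)) ⟩
    F.sumSh (λ w' → F.sumSh G w' w) u v
      ≈⟨ F.sumSh-assoc G u v w ⟩
    F.sumSh (F.sumSh G u) v w
      ≈⟨ ext-mulG rep-b rep-d v≺w (λ w' g p r → mulG-sum rep-a r (≺-↭ʳ p u≺v u≺w)) ⟨
    ext (mulG a) (mulG b d) ∎
    where
    open SeparatedWords (separated-words a b d)
    open TermReasoning RelF
    mulG-sum : ∀ {N} {u v : List (Letter N)} {a b} → Rep u a → Rep v b → u ≺ v →
               mulG a b ≈F F.sumSh G u v
    mulG-sum {a = a} {b} ra rb u≺v = Cl.trans (≈-reflexive (sym (ext-gen (mulG a b))))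
      (ext-mulG ra rb u≺v (λ _ _ _ → gen-canon))

  *-assoc : ∀ x y z → (x * y) * z ≈F x * (y * z)
  *-assoc x y z = begin
    (x * y) * z
      ≡⟨ *-ext (x * y) z ⟩
    ext (λ g → ext (mulG g) z) (x * y)
      ≡⟨ cong (ext (λ g → ext (mulG g) z)) (*-ext x y) ⟩
    ext (λ g → ext (mulG g) z) (ext (λ a → ext (mulG a) y) x)
      ≡⟨ trans (ext-∘ _ _ x) (ext-≗ (λ a → ext-∘ _ _ y) x) ⟩
    ext (λ a → ext (λ b → ext (λ g → ext (mulG g) z) (mulG a b)) y) x
      -- Pulling the sum over z out of the sum over `mulG a b` leaves three fixed generators.
      ≈⟨ ext-cong (λ a → ext-cong (λ b → ext-swap mulG (mulG a b) z) y) x ⟩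
    ext (λ a → ext (λ b → ext (λ d → ext (λ g → mulG g d) (mulG a b)) z) y) x
      ≈⟨ ext-cong (λ a → ext-cong (λ b → ext-cong (λ d → mulG-assoc a b d) z) y) x ⟩
    ext (λ a → ext (λ b → ext (λ d → ext (mulG a) (mulG b d)) z) y) x
      ≡⟨ ext-≗ (λ a → trans (ext-∘ _ _ y) (ext-≗ (λ b → ext-∘ _ _ z) y)) x ⟨
    ext (λ a → ext (mulG a) (ext (λ b → ext (mulG b) z) y)) x
      ≡⟨ ext-≗ (λ a → cong (ext (mulG a)) (*-ext y z)) x ⟨
    ext (λ a → ext (mulG a) (y * z)) x
      ≡⟨ *-ext x (y * z) ⟨
    x * (y * z) ∎
    where open TermReasoning RelF

  ext-identity : ∀ {φ : GenF → Term GenF} → (∀ a → φ a ≈F gen a) → ∀ x → ext φ x ≈F x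
  ext-identity e x = Cl.trans (ext-cong e x) (≈-reflexive (ext-gen x))

  *-identityˡ : ∀ x → unit 1ₖ * x ≈F x
  *-identityˡ x = Cl.trans ⊙-identity (Cl.trans (≈-reflexive (*-ext (gen 𝟙) x)) (ext-identity mulG-𝟙 x))
    where
    mulG-𝟙 : ∀ a → mulG 𝟙 a ≈F gen a
    mulG-𝟙 a = Cl.trans (≈-reflexive (sym (ext-gen (mulG 𝟙 a))))
      (Cl.trans (ext-mulG Rep-𝟙 rep-a (λ ()) (λ _ _ _ → gen-canon)) (Cl.sym (gen-canon rep-a)))
      where open SeparatedWords (separated-words a 𝟙 𝟙)

  *-identityʳ : ∀ x → x * unit 1ₖ ≈F x
  *-identityʳ x = Cl.trans (≈-reflexive (*-ext x (unit 1ₖ)))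
    (ext-identity (λ a → Cl.trans ⊙-identity (mulG-𝟙 a)) x)
    where
    mulG-𝟙 : ∀ a → mulG a 𝟙 ≈F gen a
    mulG-𝟙 a = Cl.trans (≈-reflexive (sym (ext-gen (mulG a 𝟙))))
      (Cl.trans (ext-mulG rep-a Rep-𝟙 (λ _ ()) (λ _ _ _ → gen-canon))
        (Cl.trans (≈-reflexive (F.sumSh-[]ʳ G u)) (Cl.sym (gen-canon rep-a))))
      where open SeparatedWords (separated-words a 𝟙 𝟙)

  Δ-coassoc : ∀ x → Δ⊗id∘Δ x ≈FFF id⊗Δ∘Δ x
  Δ-coassoc x = Cl.trans (≈-reflexive (ext-∘ _ coprodG x))
    (Cl.trans (ext-cong coassoc x) (Cl.sym (≈-reflexive (ext-∘ _ coprodG x))))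
    where
    open TermReasoning RelFFF
    GGG : ∀ {N} → List (Letter N) → List (Letter N) → List (Letter N) → Term (GenF × (GenF × GenF))
    GGG u v w = gen (canon u , (canon v , canon w))
    GGG-cong : ∀ {N} {u v w : List (Letter N)} {a b d} → Rep u a → Rep v b → Rep w d →
               gen (a , (b , d)) ≈FFF GGG u v w
    GGG-cong ra rb rd = gen-cong₂ (gen-canon ra) (gen-cong₂ (gen-canon rb) (gen-canon rd))
    coassoc : ∀ a → ext _ (coprodG a) ≈FFF ext _ (coprodG a)
    coassoc a = begin
      ext (λ p → mapT (λ q → (proj₁ (proj₁ q) , (proj₂ (proj₁ q) , proj₂ q)))
                      (coprodG (proj₁ p) ⊗ₜ gen (proj₂ p))) (coprodG a)
        ≈⟨ ext-coprodG rep-a (λ _ _ g h _ r s → Cl.trans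
             (≈-reflexive (ext-∘ _ (λ q → gen (q , h)) (coprodG g)))
             (ext-coprodG r (λ _ _ _ _ _ r' r'' → GGG-cong r' r'' s))) ⟩
      FFF.sumDec (λ v w → FFF.sumDec (λ v' v'' → GGG v' v'' w) v) u
        ≈⟨ FFF.sumDec-coassoc GGG u ⟩
      FFF.sumDec (λ v w → FFF.sumDec (GGG v) w) u
        ≈⟨ ext-coprodG rep-a (λ _ _ _ _ _ r s →
             ext-coprodG s (λ _ _ _ _ _ s' s'' → GGG-cong r s' s'')) ⟨
      ext (λ p → gen (proj₁ p) ⊗ₜ coprodG (proj₂ p)) (coprodG a) ∎
      where open SeparatedWords (separated-words a 𝟙 𝟙)

  ε-counitˡ : ∀ x → ε⊗id∘Δ x ≈F x
  ε-counitˡ x = Cl.trans (≈-reflexive (ext-∘ _ coprodG x)) (ext-identity counit x)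
    where
    Φ : ∀ {N} → List (Letter N) → List (Letter N) → Term GenF
    Φ []      v = G v
    Φ (_ ∷ _) _ = 𝟘
    -- The degree of a generator is the length of any word spelling it, so only the empty initial
    -- part has weight one; mismatched lengths contradict `spells`.
    cut-weight : ∀ {N} (u v : List (Letter N)) {g h} → Rep u g → Rep v h → (εG g ⊙ gen h) ≈F Φ u v
    cut-weight []      v {zero  , _} r s = Cl.trans ⊙-identity (gen-canon s)
    cut-weight []      v {suc _ , _} (rep _ _ _ ()) s
    cut-weight (_ ∷ _) v {zero  , _} (rep _ _ _ ()) s
    cut-weight (_ ∷ _) v {suc _ , _} r s = ⊙-zeroˡ
    counit : ∀ a → ext (λ p → εG (proj₁ p) ⊙ gen (proj₂ p)) (coprodG a) ≈F gen a
    counit a = Cl.trans (ext-coprodG rep-a (λ u v _ _ _ → cut-weight u v))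
      (Cl.trans (F.sumDec-counitˡ u (λ _ _ _ → Cl.refl)) (Cl.sym (gen-canon rep-a)))
      where open SeparatedWords (separated-words a 𝟙 𝟙)

  ε-counitʳ : ∀ x → id⊗ε∘Δ x ≈F x
  ε-counitʳ x = Cl.trans (≈-reflexive (ext-∘ _ coprodG x)) (ext-identity counit x)
    where
    Φ : ∀ {N} → List (Letter N) → List (Letter N) → Term GenF
    Φ u []      = G u
    Φ _ (_ ∷ _) = 𝟘
    cut-weight : ∀ {N} (u v : List (Letter N)) {g h} → Rep u g → Rep v h → (εG h ⊙ gen g) ≈F Φ u v
    cut-weight u []      {h = zero  , _} r s = Cl.trans ⊙-identity (gen-canon r)
    cut-weight u []      {h = suc _ , _} r (rep _ _ _ ())
    cut-weight u (_ ∷ _) {h = zero  , _} r (rep _ _ _ ())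
    cut-weight u (_ ∷ _) {h = suc _ , _} r s = ⊙-zeroˡ
    counit : ∀ a → ext (λ p → εG (proj₂ p) ⊙ gen (proj₁ p)) (coprodG a) ≈F gen a
    counit a = Cl.trans (ext-coprodG rep-a (λ u v _ _ _ → cut-weight u v))
      (Cl.trans (F.sumDec-counitʳ u (λ _ _ _ → Cl.refl)) (Cl.sym (gen-canon rep-a)))
      where open SeparatedWords (separated-words a 𝟙 𝟙)

  GG : ∀ {N} → List (Letter N) → List (Letter N) → Term (GenF × GenF)
  GG u v = gen (canon u , canon v)

  coprodG-sum : ∀ {N} {w : List (Letter N)} {a} → Rep w a → coprodG a ≈FF FF.sumDec GG w
  coprodG-sum {a = a} r = Cl.trans (≈-reflexive (sym (ext-gen (coprodG a))))
    (ext-coprodG r (λ _ _ _ _ _ r s → gen-cong₂ (gen-canon r) (gen-canon s)))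

  Δ-unit : Δ (unit 1ₖ) ≈FF gen (𝟙 , 𝟙)
  Δ-unit = Cl.trans ⊙-identity (Cl.trans (coprodG-sum {N = 0} Rep-𝟙)
    (Cl.sym (gen-cong₂ (gen-canon {N = 0} Rep-𝟙) (gen-canon {N = 0} Rep-𝟙))))

  mulG₂ : GenF × GenF → GenF × GenF → Term (GenF × GenF)
  mulG₂ p q = mulG (proj₁ p) (proj₁ q) ⊗ₜ mulG (proj₂ p) (proj₂ q)

  -- Parts of u keep their labels below those of parts of v. Hence both inner products are shuffle
  -- sums on the original labels, and `sumDec-sumSh` compares the two sides.
  coprodG-mulG : ∀ a b → ext coprodG (mulG a b) ≈FF ext (λ p → ext (mulG₂ p) (coprodG b)) (coprodG a)
  coprodG-mulG a b = begin
    ext coprodG (mulG a b)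
      ≈⟨ ext-mulG rep-a rep-b u≺v (λ _ _ _ → coprodG-sum) ⟩
    FF.sumSh (FF.sumDec GG) u v
      ≈⟨ FF.sumDec-sumSh GG u v ⟩
    FF.sumDec (λ u₁ u₂ → FF.sumDec (λ v₁ v₂ → FF.sumSh (λ x → FF.sumSh (GG x) u₂ v₂) u₁ v₁) v) u
      ≈⟨ ext-coprodG rep-a (λ u₁ u₂ _ _ u≡ ra₁ ra₂ → ext-coprodG rep-b (λ v₁ v₂ _ _ v≡ rb₁ rb₂ →
           ext-mulG ra₁ rb₁ (λ x∈ y∈ → u≺v (subst (_ ∈_) u≡ (∈-++⁺ˡ x∈)) (subst (_ ∈_) v≡ (∈-++⁺ˡ y∈)))
             (λ _ _ _ r → ext-mulG ra₂ rb₂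
               (λ x∈ y∈ → u≺v (subst (_ ∈_) u≡ (∈-++⁺ʳ u₁ x∈)) (subst (_ ∈_) v≡ (∈-++⁺ʳ v₁ y∈)))
               (λ _ _ _ s → gen-cong₂ (gen-canon r) (gen-canon s))))) ⟨
    ext (λ p → ext (mulG₂ p) (coprodG b)) (coprodG a) ∎
    where
    open SeparatedWords (separated-words a b 𝟙)
    open TermReasoning RelFF

  Δ-* : ∀ x y → Δ (x * y) ≈FF (Δ x *₂ Δ y)
  Δ-* x y = begin
    Δ (x * y)
      ≡⟨ cong Δ (*-ext x y) ⟩
    Δ (ext (λ a → ext (mulG a) y) x)
      ≡⟨ trans (ext-∘ _ _ x) (ext-≗ (λ a → ext-∘ _ _ y) x) ⟩
    ext (λ a → ext (λ b → Δ (mulG a b)) y) x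
      ≈⟨ ext-cong (λ a → ext-cong (λ b → coprodG-mulG a b) y) x ⟩
    ext (λ a → ext (λ b → ext (λ p → ext (mulG₂ p) (coprodG b)) (coprodG a)) y) x
      ≈⟨ ext-cong (λ a → ext-swap (λ p b → ext (mulG₂ p) (coprodG b)) (coprodG a) y) x ⟨
    ext (λ a → ext (λ p → ext (λ b → ext (mulG₂ p) (coprodG b)) y) (coprodG a)) x
      ≡⟨ ext-≗ (λ a → ext-≗ (λ p → ext-∘ (mulG₂ p) coprodG y) (coprodG a)) x ⟨
    ext (λ a → ext (λ p → ext (mulG₂ p) (Δ y)) (coprodG a)) x
      ≡⟨ ext-∘ (λ p → ext (mulG₂ p) (Δ y)) coprodG x ⟨
    ext (λ p → ext (mulG₂ p) (Δ y)) (Δ x)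
      ≡⟨ ext-⊗ (λ q → mulG₂ (proj₁ q) (proj₂ q)) (Δ x) (Δ y) ⟨
    Δ x *₂ Δ y ∎
    where open TermReasoning RelFF

  -- Multilinearity

  []≔-same : ∀ {n} (v : Fin n → Carrierᴹ) i z → (v [ i ]≔ z) i ≡ z
  []≔-same v i z with i Fin.≟ i
  ... | yes _  = refl
  ... | no i≢i = ⊥-elim (i≢i refl)

  []≔-other : ∀ {n} (v : Fin n → Carrierᴹ) {i j} z → i ≢ j → (v [ i ]≔ z) j ≡ v j
  []≔-other v {i} {j} z i≢j with i Fin.≟ j
  ... | yes i≡j = ⊥-elim (i≢j i≡j)
  ... | no  _   = refl

  []≔-∘ : ∀ {n p} (v : Fin n → Carrierᴹ) {e : Fin p → Fin n} → Inj e → ∀ k z j →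
          (v [ e k ]≔ z) (e j) ≡ ((v ∘ e) [ k ]≔ z) j
  []≔-∘ v {e} e-inj k z j with k Fin.≟ j
  ... | yes refl = []≔-same v (e k) z
  ... | no  k≢j  = []≔-other v z (k≢j ∘ e-inj)

  gen-≗ : ∀ {n} {v w : Fin n → Carrierᴹ} {σ : Perm n} → v ≗ w → gen (n , v , σ) ≈F gen (n , w , σ)
  gen-≗ e = base (respects-≈ _ _ _ (λ i → ≈ᴹ-reflexive (e i)))

  -- `multilinear` speaks of literal updates, whereas concatenation, permutation and restriction
  -- produce vectors that agree with an update only pointwise.
  gen-linear : ∀ {n} (v : Fin n → Carrierᴹ) i {U : Carrierᴹ → Fin n → Carrierᴹ} {σ} →
               (∀ z → U z ≗ (v [ i ]≔ z)) → ∀ a x y →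
               gen (n , U (a *ₗ x +ᴹ y) , σ) ≈F (a ⊙ gen (n , U x , σ) ⊕ gen (n , U y , σ))
  gen-linear v i {U} {σ} U≗ a x y = Cl.trans (gen-≗ (U≗ (a *ₗ x +ᴹ y)))
    (Cl.trans (base (multilinear v σ i a x y))
      (⊕-cong (⊙-cong K.refl (gen-≗ (λ j → sym (U≗ x j)))) (gen-≗ (λ j → sym (U≗ y j)))))

  module _ {n n'} (v : Fin n → Carrierᴹ) (v' : Fin n' → Carrierᴹ) where

    ++-[]≔ˡ : ∀ i z → ((v [ i ]≔ z) ++ᵛ v') ≗ ((v ++ᵛ v') [ i ↑ˡ n' ]≔ z)
    ++-[]≔ˡ i z x with splitView n n' x
    ... | fromˡ j = trans (cong [ v [ i ]≔ z , v' ]′ (Fin.splitAt-↑ˡ n j n'))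
      (trans (lemma j) (sym ([]≔-∘ (v ++ᵛ v') (Fin.↑ˡ-injective n' _ _) i z j)))
      where
      lemma : (v [ i ]≔ z) ≗ ((λ j → (v ++ᵛ v') (j ↑ˡ n')) [ i ]≔ z)
      lemma j with i Fin.≟ j
      ... | yes _ = refl
      ... | no  _ = sym (cong [ v , v' ]′ (Fin.splitAt-↑ˡ n j n'))
    ... | fromʳ j = trans (cong [ v [ i ]≔ z , v' ]′ (Fin.splitAt-↑ʳ n n' j))
      (sym (trans ([]≔-other (v ++ᵛ v') z (↑ˡ≢↑ʳ {i = i} {j}))
                  (cong [ v , v' ]′ (Fin.splitAt-↑ʳ n n' j))))

    ++-[]≔ʳ : ∀ i z → (v ++ᵛ (v' [ i ]≔ z)) ≗ ((v ++ᵛ v') [ n ↑ʳ i ]≔ z)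
    ++-[]≔ʳ i z x with splitView n n' x
    ... | fromˡ j = trans (cong [ v , v' [ i ]≔ z ]′ (Fin.splitAt-↑ˡ n j n'))
      (sym (trans ([]≔-other (v ++ᵛ v') z (λ e → ↑ˡ≢↑ʳ (sym e)))
                  (cong [ v , v' ]′ (Fin.splitAt-↑ˡ n j n'))))
    ... | fromʳ j = trans (cong [ v , v' [ i ]≔ z ]′ (Fin.splitAt-↑ʳ n n' j))
      (trans (lemma j) (sym ([]≔-∘ (v ++ᵛ v') (Fin.↑ʳ-injective n _ _) i z j)))
      where
      lemma : (v' [ i ]≔ z) ≗ ((λ j → (v ++ᵛ v') (n ↑ʳ j)) [ i ]≔ z)
      lemma j with i Fin.≟ j
      ... | yes _ = refl
      ... | no  _ = sym (cong [ v , v' ]′ (Fin.splitAt-↑ʳ n n' j))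

  -- π carries the varying slot from i to `decode π i`, where the permuted vector is updated.
  act-linear : ∀ {n} (v : Fin n → Carrierᴹ) i {U : Carrierᴹ → Fin n → Carrierᴹ} {σ} →
               (∀ z → U z ≗ (v [ i ]≔ z)) → ∀ a x y π →
               act π (U (a *ₗ x +ᴹ y)) σ ≈F (a ⊙ act π (U x) σ ⊕ act π (U y) σ)
  act-linear v i {U} {σ} U≗ a x y π =
    gen-linear (v ∘ decode⁻¹ π) (decode π i) {λ z → U z ∘ decode⁻¹ π} {π ∘ₚ σ} (λ z j →
    trans (U≗ z (decode⁻¹ π j)) (trans
      (cong (λ k → (v [ k ]≔ z) (decode⁻¹ π j)) (sym (inverseˡ π i)))
      ([]≔-∘ v (decode⁻¹-Inj π) (decode π i) z j))) a x y

  act-cong : ∀ {n} {v w : Fin n → Carrierᴹ} {σ} → (∀ i → v i ≈ᴹ w i) → ∀ π → act π v σ ≈F act π w σ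
  act-cong {σ = σ} e π = base (respects-≈ _ _ (π ∘ₚ σ) (λ i → e (decode⁻¹ π i)))

  ++-cong : ∀ {n n'} {v w : Fin n → Carrierᴹ} {v' w' : Fin n' → Carrierᴹ} →
            (∀ i → v i ≈ᴹ w i) → (∀ i → v' i ≈ᴹ w' i) → ∀ i → (v ++ᵛ v') i ≈ᴹ (w ++ᵛ w') i
  ++-cong {n} e e' i with splitAt n i
  ... | inj₁ j = e j
  ... | inj₂ j = e' j

  mul-left : ∀ {x y} → RelF x y → ∀ b → ext (λ a → mulG a b) x ≈F ext (λ a → mulG a b) y
  mul-left (multilinear {n} v σ i a x y) (n' , v' , σ') = sumT-linear (shuffles n n')
    (act-linear (v ++ᵛ v') (i ↑ˡ n') {λ z → (v [ i ]≔ z) ++ᵛ v'} {σ ×ₚ σ'} (++-[]≔ˡ v v' i) a x y)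
  mul-left (respects-≈ {n} v w σ e) (n' , v' , σ') = F.sum-cong (shuffles n n')
    (λ {π} _ → act-cong {σ = σ ×ₚ σ'} (++-cong {v' = v'} e (λ _ → ≈ᴹ-refl)) π)

  mul-right : ∀ {x y} a → RelF x y → ext (mulG a) x ≈F ext (mulG a) y
  mul-right (n' , v' , σ') (multilinear {n} v σ i a x y) = sumT-linear (shuffles n' n)
    (act-linear (v' ++ᵛ v) (n' ↑ʳ i) {λ z → v' ++ᵛ (v [ i ]≔ z)} {σ' ×ₚ σ} (++-[]≔ʳ v' v i) a x y)
  mul-right (n' , v' , σ') (respects-≈ {n} v w σ e) = F.sum-cong (shuffles n' n)
    (λ {π} _ → act-cong {σ = σ' ×ₚ σ} (++-cong {v = v'} (λ _ → ≈ᴹ-refl) e) π)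

  *-cong : ∀ {x y} → x ≈FF y → mul x ≈F mul y
  *-cong = ext-resp respects
    where
    respects : ∀ {x y} → RelFF x y → mul x ≈F mul y
    respects (left {x} {y} r b) = Cl.trans (≈-reflexive (ext-∘ _ _ x))
      (Cl.trans (mul-left r b) (≈-reflexive (sym (ext-∘ _ _ y))))
    respects (right {x} {y} a r) = Cl.trans (≈-reflexive (ext-∘ _ _ x))
      (Cl.trans (mul-right a r) (≈-reflexive (sym (ext-∘ _ _ y))))

  data CutView {n} (k : Cut n) : Fin n → Set where
    in-initial : ∀ i → CutView k (initial k i)
    in-final   : ∀ j → CutView k (final k j)

  cutView : ∀ {n} (k : Cut n) i → CutView k i
  cutView k@(p , q , refl) i = subst (CutView k) (Fin.cast-is-id refl i) (view (splitView p q i))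
    where
    view : ∀ {i} → SplitView p q i → CutView k (cast refl i)
    view (fromˡ i) = in-initial i
    view (fromʳ j) = in-final j

  initial≢final : ∀ {n} (k : Cut n) {i j} → initial k i ≢ final k j
  initial≢final (p , q , refl) {i} {j} e = ↑ˡ≢↑ʳ {i = i} {j}
    (trans (sym (Fin.cast-is-id refl (i ↑ˡ q))) (trans e (Fin.cast-is-id refl (p ↑ʳ j))))

  restrict-linear : ∀ {n p} (v : Fin n → Carrierᴹ) σ {e : Fin p → Fin n} → Inj e → ∀ k a x y →
    gen (restrict e (v [ e k ]≔ (a *ₗ x +ᴹ y)) σ) ≈F
    (a ⊙ gen (restrict e (v [ e k ]≔ x) σ) ⊕ gen (restrict e (v [ e k ]≔ y) σ))
  restrict-linear v σ {e} e-inj k =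
    gen-linear (v ∘ e) k {λ z → (v [ e k ]≔ z) ∘ e} {encode (inv (std (decode⁻¹ σ ∘ e)))}
      ([]≔-∘ v e-inj k)

  restrict-other : ∀ {n p} (v : Fin n → Carrierᴹ) σ {e : Fin p → Fin n} i → (∀ j → i ≢ e j) → ∀ x y →
    gen (restrict e (v [ i ]≔ x) σ) ≈F gen (restrict e (v [ i ]≔ y) σ)
  restrict-other v σ {e} i i≢e x y = gen-≗ {σ = encode (inv (std (decode⁻¹ σ ∘ e)))} (λ j →
    trans ([]≔-other v x (i≢e j)) (sym ([]≔-other v y (i≢e j))))

  -- The varying slot falls into exactly one of the two parts, and that part is linear in it. The
  -- other part still mentions the update but never reads it, so it can be rewritten to match either
  -- summand.
  piece-linear : ∀ {n} (v : Fin n → Carrierᴹ) σ i a x y k →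
    gen (piece (v [ i ]≔ (a *ₗ x +ᴹ y)) σ k) ≈FF
    (a ⊙ gen (piece (v [ i ]≔ x) σ k) ⊕ gen (piece (v [ i ]≔ y) σ k))
  piece-linear v σ i a x y k with cutView k i
  ... | in-initial i = Cl.trans
    (tensor-congˡ (fixed (a *ₗ x +ᴹ y)) (restrict-linear v σ (initial-Inj k) i a x y))
    (⊕-cong (⊙-cong K.refl (tensor-congʳ (moving x) (unchanged x)))
            (tensor-congʳ (moving y) (unchanged y)))
    where
    moving fixed : Carrierᴹ → GenF
    moving z = restrict (initial k) (v [ initial k i ]≔ z) σ
    fixed  z = restrict (final k) (v [ initial k i ]≔ z) σ
    unchanged : ∀ z → gen (fixed (a *ₗ x +ᴹ y)) ≈F gen (fixed z)
    unchanged = restrict-other v σ (initial k i) (λ _ → initial≢final k) (a *ₗ x +ᴹ y)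
  ... | in-final j = Cl.trans
    (tensor-congʳ (fixed (a *ₗ x +ᴹ y)) (restrict-linear v σ (final-Inj k) j a x y))
    (⊕-cong (⊙-cong K.refl (tensor-congˡ (moving x) (unchanged x)))
            (tensor-congˡ (moving y) (unchanged y)))
    where
    moving fixed : Carrierᴹ → GenF
    moving z = restrict (final k) (v [ final k j ]≔ z) σ
    fixed  z = restrict (initial k) (v [ final k j ]≔ z) σ
    unchanged : ∀ z → gen (fixed (a *ₗ x +ᴹ y)) ≈F gen (fixed z)
    unchanged = restrict-other v σ (final k j) (λ _ e → initial≢final k (sym e)) (a *ₗ x +ᴹ y)

  Δ-cong : ∀ {x y} → x ≈F y → Δ x ≈FF Δ y
  Δ-cong = ext-resp respects
    where
    respects : ∀ {x y} → RelF x y → Δ x ≈FF Δ y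
    respects (multilinear {n} v σ i a x y) = sumT-linear
      {t = λ k → gen (piece (v [ i ]≔ x) σ k)} {u = λ k → gen (piece (v [ i ]≔ y) σ k)} (splits n)
      (piece-linear v σ i a x y)
    respects (respects-≈ {n} v w σ e) = FF.sum-cong (splits n)
      (λ {k} _ → gen-cong₂ (base (respects-≈ _ _ _ (λ i → e (initial k i))))
                           (base (respects-≈ _ _ _ (λ i → e (final k i)))))

  -- Counit and grading

  ε-cong : ∀ {x y} → x ≈F y → ε x ≈ₖ ε y
  -- The slot i rules out degree zero, so ε kills every generator in the relation.
  ε-cong (base (multilinear {suc n} v σ i a x y)) =
    K.sym (K.trans (K.+-identityʳ _) (K.zeroʳ a))
  ε-cong (base (respects-≈ {zero} v w σ e))  = K.refl
  ε-cong (base (respects-≈ {suc n} v w σ e)) = K.refl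
  ε-cong Cl.refl        = K.refl
  ε-cong (Cl.sym p)     = K.sym (ε-cong p)
  ε-cong (Cl.trans p q) = K.trans (ε-cong p) (ε-cong q)
  ε-cong (⊕-cong p q)   = K.+-cong (ε-cong p) (ε-cong q)
  ε-cong (⊙-cong a p)   = K.*-cong a (ε-cong p)
  ε-cong ⊕-assoc        = K.+-assoc _ _ _
  ε-cong ⊕-comm         = K.+-comm _ _
  ε-cong ⊕-identity     = K.+-identityˡ _
  ε-cong ⊕-inverse      = K.trans (K.+-congˡ (-1*x≈-x _)) (K.-‿inverseʳ _)
    where open RingProperties K.ring using (-1*x≈-x)
  ε-cong ⊙-assoc        = K.*-assoc _ _ _
  ε-cong ⊙-identity     = K.*-identityˡ _
  ε-cong ⊙-distribˡ     = K.distribˡ _ _ _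
  ε-cong ⊙-distribʳ     = K.distribʳ _ _ _

  ε-Homog : ∀ {d x} → d ≢ 0 → Homog d x → ε x ≈ₖ 0ₖ
  ε-Homog d≢0 (gen (zero  , _) refl) = ⊥-elim (d≢0 refl)
  ε-Homog d≢0 (gen (suc n , _) _)    = K.refl
  ε-Homog d≢0 𝟘       = K.refl
  ε-Homog d≢0 (p ⊕ q) = K.trans (K.+-cong (ε-Homog d≢0 p) (ε-Homog d≢0 q)) (K.+-identityˡ _)
  ε-Homog d≢0 (a ⊙ p) = K.trans (K.*-congˡ (ε-Homog d≢0 p)) (K.zeroʳ a)

  *-graded : ∀ a b → Homog (deg a + deg b) (mulG a b)
  *-graded (n , v , σ) (n' , v' , σ') = go (shuffles n n')
    where
    go : ∀ πs → Homog (n + n') (sumT (map (λ π → act π (v ++ᵛ v') (σ ×ₚ σ')) πs))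
    go []       = 𝟘
    go (π ∷ πs) = gen _ refl ⊕ go πs

  Δ-graded : ∀ a → Homog₂ (deg a) (coprodG a)
  Δ-graded (n , v , σ) = go (splits n)
    where
    go : ∀ ks → Homog₂ n (sumT (map (λ k → gen (piece v σ k)) ks))
    go []       = 𝟘
    go ((_ , _ , eq) ∷ ks) = gen _ _ eq ⊕ go ks

  -- Unless both degrees are zero, the product is homogeneous of positive degree, where ε vanishes.
  -- In degree zero there is a single shuffle and the value computes.
  ε-mulG : ∀ a b → ε (mulG a b) ≈ₖ (εG a *ₖ εG b)
  ε-mulG (zero  , _) (zero  , _)   = K.trans (K.+-identityʳ _) (K.sym (K.*-identityˡ _))
  ε-mulG a@(zero , _) b@(suc n , _) = K.trans (ε-Homog (λ ()) (*-graded a b)) (K.sym (K.zeroʳ _))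
  ε-mulG a@(suc n , _) b           = K.trans (ε-Homog (λ ()) (*-graded a b)) (K.sym (K.zeroˡ _))

  ε-* : ∀ x y → ε (x * y) ≈ₖ (ε x *ₖ ε y)
  ε-* 𝟘        y = K.sym (K.zeroˡ _)
  ε-* (x ⊕ x') y = K.trans (K.+-cong (ε-* x y) (ε-* x' y)) (K.sym (K.distribʳ _ _ _))
  ε-* (a ⊙ x)  y = K.trans (K.*-congˡ (ε-* x y)) (K.sym (K.*-assoc _ _ _))
  ε-* (gen a)  (gen b)  = ε-mulG a b
  ε-* (gen a)  𝟘        = K.sym (K.zeroʳ _)
  ε-* (gen a)  (y ⊕ y') = K.trans (K.+-cong (ε-* (gen a) y) (ε-* (gen a) y')) (K.sym (K.distribˡ _ _ _))
  ε-* (gen a)  (b ⊙ y)  = K.trans (K.*-congˡ (ε-* (gen a) y)) (x∙yz≈y∙xz _ _ _)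
    where open CommutativeSemigroupProperties K.*-commutativeSemigroup using (x∙yz≈y∙xz)

  isGradedBialgebra : IsGradedBialgebra
  isGradedBialgebra = record
    { *-cong = *-cong ; Δ-cong = Δ-cong ; ε-cong = ε-cong
    ; *-assoc = *-assoc ; *-identityˡ = *-identityˡ ; *-identityʳ = *-identityʳ
    ; Δ-coassoc = Δ-coassoc ; ε-counitˡ = ε-counitˡ ; ε-counitʳ = ε-counitʳ
    ; Δ-* = Δ-* ; Δ-unit = Δ-unit ; ε-* = ε-* ; ε-unit = K.*-identityˡ 1ₖ
    ; *-graded = *-graded ; Δ-graded = Δ-graded ; unit-graded = gen 𝟙 refl
    ; ε-graded = λ { (zero , _) d≢0 → ⊥-elim (d≢0 refl) ; (suc _ , _) _ → K.refl }
    }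

theorem1p1 : ∀ {c ℓ m ℓm} (K : CommutativeRing c ℓ) (V : Module K m ℓm) →
    Construction.IsGradedBialgebra K V
theorem1p1 = isGradedBialgebra
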